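{- Let $H_1,H_2,H_3$ be the 3-graphs on vertex set $\{1,2,3,4,5\}$ with edge sets $E(H_1)=\{123,124,134,234,125,345\}$, $E(H_2)=\{123,124,134,234,135,145,235,245\}$, $E(H_3)=\{123,124,134,234,125,135,145,235,245\}$, and let $I^3_4$ be the 3-graph on 4 vertices with no edges. Then $$\pi_{\min}(I^3_4,H_1,H_2,H_3)=\frac49 .$$
   Context: A 3-graph is a 3-uniform hypergraph. For a finite family $\mathcal H$ of 3-graphs and an integer $n$, $\mathrm{ex}_{\min}(n;\mathcal H)$ denotes the minimal possible number of edges in an $n$-vertex 3-graph containing no member of $\mathcal H$ as an induced subgraph, and $\pi_{\min}(\mathcal H)=\lim_{n\to\infty}\mathrm{ex}_{\min}(n;\mathcal H)/\binom n3$ (this limit exists). -}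

module Defs where

import Data.Nat
open import Data.Nat using (ℕ; _*_; _≤_; _<_; _<ᵇ_; ∣_-_∣)
open import Data.Nat.Combinatorics using (_C_)
open import Data.Bool using (Bool; true; false; _∧_; if_then_else_)
open import Data.Bool.Properties using () renaming (_≟_ to _≟ᵇ_)
open import Data.Fin using (Fin; toℕ; zero; suc) renaming (_<_ to _<ꟳ_)
open import Data.Fin.Subset using (Subset; ⁅_⁆; _∪_)
open import Data.List using (List; []; _∷_; map)
open import Data.Nat.ListAction using (sum)
open import Data.Bool.ListAction using (any)
open import Data.List.Base using (allFin)
open import Data.Vec.Properties using (≡-dec)
open import Data.Product using (Σ; ∃; _×_; _,_)
open import Relation.Nullary using (¬_)
open import Relation.Nullary.Decidable using (⌊_⌋)
open import Relation.Binary.PropositionalEquality using (_≡_)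
open import Function.Definitions using (Injective)

-- A 3-graph on vertex set Fin n: an indicator of which subsets are edges.
-- Only its values on 3-element subsets matter.
Graph3 : ℕ → Set
Graph3 n = Subset n → Bool

tri : ∀ {n} → Fin n → Fin n → Fin n → Subset n
tri a b c = ⁅ a ⁆ ∪ (⁅ b ⁆ ∪ ⁅ c ⁆)

edges : ∀ {n} → Graph3 n → ℕ
edges {n} G =
  sum (map (λ a → sum (map (λ b → sum (map (λ c →
    if (toℕ a <ᵇ toℕ b) ∧ (toℕ b <ᵇ toℕ c) ∧ G (tri a b c) then 1 else 0)
    (allFin n))) (allFin n))) (allFin n))

InducedIn : ∀ {m n} → Graph3 m → Graph3 n → Set
InducedIn {m} {n} H G =
  Σ (Fin m → Fin n) λ f → Injective _≡_ _≡_ f ×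
    (∀ a b c → a <ꟳ b → b <ꟳ c → H (tri a b c) ≡ G (tri (f a) (f b) (f c)))

fromList : ∀ {n} → List (Fin n × Fin n × Fin n) → Graph3 n
fromList es S = any (λ { (a , b , c) → ⌊ ≡-dec _≟ᵇ_ S (tri a b c) ⌋ }) es

private
  v1 v2 v3 v4 v5 : Fin 5
  v1 = zero
  v2 = suc zero
  v3 = suc (suc zero)
  v4 = suc (suc (suc zero))
  v5 = suc (suc (suc (suc zero)))

I34 : Graph3 4
I34 _ = false

H1 : Graph3 5
H1 = fromList ((v1 , v2 , v3) ∷ (v1 , v2 , v4) ∷ (v1 , v3 , v4) ∷ (v2 , v3 , v4)
              ∷ (v1 , v2 , v5) ∷ (v3 , v4 , v5) ∷ [])

H2 : Graph3 5
H2 = fromList ((v1 , v2 , v3) ∷ (v1 , v2 , v4) ∷ (v1 , v3 , v4) ∷ (v2 , v3 , v4)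
              ∷ (v1 , v3 , v5) ∷ (v1 , v4 , v5) ∷ (v2 , v3 , v5) ∷ (v2 , v4 , v5) ∷ [])

H3 : Graph3 5
H3 = fromList ((v1 , v2 , v3) ∷ (v1 , v2 , v4) ∷ (v1 , v3 , v4) ∷ (v2 , v3 , v4)
              ∷ (v1 , v2 , v5) ∷ (v1 , v3 , v5) ∷ (v1 , v4 , v5) ∷ (v2 , v3 , v5)
              ∷ (v2 , v4 , v5) ∷ [])

Free : ∀ {n} → Graph3 n → Set
Free G = ¬ InducedIn I34 G × ¬ InducedIn H1 G × ¬ InducedIn H2 G × ¬ InducedIn H3 G

IsExMin : ℕ → ℕ → Set
IsExMin n m = (Σ (Graph3 n) λ G → Free G × edges G ≡ m)
            × (∀ (G : Graph3 n) → Free G → m ≤ edges G)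

-- π_min = 4/9:  for every ε = 1/(k+1) there is N such that for all n ≥ N,
-- ex_min(n) exists and | ex_min(n)/C(n,3) - 4/9 | < 1/(k+1),
-- written without division as (k+1) * |9 m - 4 C(n,3)| < 9 C(n,3).
PiMinIsFourNinths : Set
PiMinIsFourNinths =
  ∀ (k : ℕ) → ∃ λ N → ∀ n → N ≤ n → ∃ λ m → IsExMin n m ×
    Data.Nat.suc k * ∣ 9 * m - 4 * (n C 3) ∣ < 9 * (n C 3)

{-# OPTIONS --safe #-}
-- Upper bound: split the vertices evenly by residue mod 3 and take the triples of residues rrr and rr(r+1).
--
-- Lower bound: fix m = 3ν. If a positive fraction of the m-tuples of vertices of a free graph G span too
-- few edges, a Kővári–Sós–Turán argument yields m pairs of twins (aᵢ, aᵢ′) all of whose 2^m transversals are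
-- such tuples, of the same isomorphism type, and such that whether aᵢaᵢ′aⱼ is an edge does not depend on the
-- choice of the twin aⱼ; then write j → i if it is an edge. The forbidden graphs I₄, H₁ and H₃, applied to
-- twins, show that mutual arrows form an equivalence relation, that the one-way arrows orient the
-- complete multipartite graph on its classes without an induced directed 4-cycle, and that every triple inside
-- a class, and every triple with a vertex dominating the two others, is an edge. With xᵢ the size of the class
-- of i and dᵢ its out-degree, a transversal thus spans about (Σ xᵢ² + 3 Σ dᵢ²)/6 edges.
--
-- This is at least 12ν³/6, that is, density 4/9. As Σ dᵢ is determined by the xᵢ, the claim is equivalent to
-- Σ xᵢ(3ν − xᵢ) ≤ 6ν³ + 3 Σ (dᵢ − ν)². The squares are only needed if the two largest classes both exceed ν and
-- the remaining vertices number ν − c with c > 0. In that case the absence of a directed 4-cycle makes the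
-- out-neighbourhoods between the two classes nested, which forces Σ (dᵢ − ν)² ≥ 1² + 2² + … + c².
--
-- So almost all m-tuples have density at least 4/9 − O(1/m), and averaging over them bounds the density of G.
module Submission where

open import Defs

import Data.Fin as F
import Data.Fin.Properties as FP
import Data.List.Base as L
import Data.Nat.ListAction as LA
open import Data.Bool using (Bool; T; true; false; _∧_; _∨_; not; if_then_else_)
open import Data.Bool.Properties using (∧-comm; ∧-assoc; ∧-zeroʳ) renaming (_≟_ to _≟ᵇ_)
open import Data.Empty using (⊥; ⊥-elim)
open import Data.Fin using (Fin; zero; suc; toℕ; _≟_; combine; remQuot; funToFin; finToFun)
open import Data.Fin.Properties using (any?; all?; pigeonhole; remQuot-combine; finToFun-funToFin; suc-injective; 0≢1+n)
open import Data.Fin.Subset using (Subset; _∪_; ⁅_⁆)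
open import Data.Fin.Subset.Properties using (∪-comm; ∪-assoc; ∪-identityˡ)
open import Data.List.Base using (map; allFin)
open import Data.List.Properties using (map-tabulate)
open import Data.Nat hiding (_≟_)
open import Data.Nat.Combinatorics using (nC1≡n; nCk+nC[k+1]≡[n+1]C[k+1]) renaming (_C_ to _C′_)
open import Data.Nat.Properties hiding (_≟_; suc-injective; 0≢1+n)
open import Data.Nat.Tactic.RingSolver using (solve-∀)
open import Data.Product using (∃; _×_; _,_; proj₁; proj₂; map₂)
open import Data.Sum using (_⊎_; inj₁; inj₂)
open import Data.Unit using (⊤; tt)
open import Data.Vec using (Vec; []; _∷_; lookup; tabulate)
open import Data.Vec.Properties using (lookup∘tabulate; lookup-zipWith; lookup-replicate)
open import Function using (_∘_; case_of_; it)
open import Function.Definitions using (Injective)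
open import Relation.Binary.Definitions using (tri<; tri≈; tri>)
open import Relation.Binary.PropositionalEquality
open import Relation.Nullary using (¬_; Dec; yes; no)
open import Relation.Nullary.Decidable using (⌊_⌋; from-yes; map′; ¬?; _×-dec_; _→-dec_)
open import Algebra.Properties.Semiring.Sum +-*-semiring using (sum; sum-cong-≗; sum-syntax; ∑-distrib-+; ∑-comm; *-distribˡ-sum; *-distribʳ-sum)

-- Sums and cardinalities

⟦_⟧ : Bool → ℕ
⟦ true ⟧  = 1
⟦ false ⟧ = 0

count : ∀ {n} → (Fin n → Bool) → ℕ
count {n} p = ∑[ i < n ] ⟦ p i ⟧

⟦⟧≤1 : ∀ b → ⟦ b ⟧ ≤ 1
⟦⟧≤1 true  = ≤-refl
⟦⟧≤1 false = z≤n

⟦⟧-mono : ∀ {a b} → (a ≡ true → b ≡ true) → ⟦ a ⟧ ≤ ⟦ b ⟧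
⟦⟧-mono {false} h = z≤n
⟦⟧-mono {true} {b} h rewrite h refl = ≤-refl

⟦∧⟧ : ∀ a b → ⟦ a ∧ b ⟧ ≡ ⟦ a ⟧ * ⟦ b ⟧
⟦∧⟧ true  b = sym (*-identityˡ ⟦ b ⟧)
⟦∧⟧ false b = refl

∧-true : ∀ {a b} → a ≡ true → b ≡ true → a ∧ b ≡ true
∧-true refl refl = refl

∧-split : ∀ {a b} → a ∧ b ≡ true → a ≡ true × b ≡ true
∧-split {true} {true} refl = refl , refl

true≢false : true ≢ false
true≢false ()

clash : ∀ {ℓ} {A : Set ℓ} {b} → b ≡ true → b ≡ false → A
clash refl ()

not-true : ∀ {b} → not b ≡ true → b ≡ false
not-true {false} refl = refl

sum-mono : ∀ {n} {f g : Fin n → ℕ} → (∀ i → f i ≤ g i) → sum f ≤ sum g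
sum-mono {zero}  h = z≤n
sum-mono {suc n} h = +-mono-≤ (h zero) (sum-mono (h ∘ suc))

sum-mono-< : ∀ {n} {f g : Fin n → ℕ} → (∀ i → f i ≤ g i) → ∀ j → f j < g j → sum f < sum g
sum-mono-< {suc n} h zero    l = +-mono-<-≤ l (sum-mono (h ∘ suc))
sum-mono-< {suc n} h (suc j) l = +-mono-≤-< (h zero) (sum-mono-< (h ∘ suc) j l)

sum-const : ∀ n c → ∑[ i < n ] c ≡ n * c
sum-const zero    c = refl
sum-const (suc n) c = cong (c +_) (sum-const n c)

sum-*ˡ : ∀ {n} c (f : Fin n → ℕ) → ∑[ i < n ] (c * f i) ≡ c * sum f
sum-*ˡ c f = sym (*-distribˡ-sum c f)

sum-*ʳ : ∀ {n} (f : Fin n → ℕ) c → ∑[ i < n ] (f i * c) ≡ sum f * c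
sum-*ʳ f c = sym (*-distribʳ-sum c f)

count-all : ∀ {n} (p : Fin n → Bool) → (∀ i → p i ≡ true) → count p ≡ n
count-all {n} p h =
  trans (sum-cong-≗ λ i → cong ⟦_⟧ (h i)) (trans (sum-const n 1) (*-identityʳ n))

count-none : ∀ {n} (p : Fin n → Bool) → (∀ i → p i ≡ false) → count p ≡ 0
count-none {n} p h =
  trans (sum-cong-≗ λ i → cong ⟦_⟧ (h i)) (trans (sum-const n 0) (*-zeroʳ n))

count-mono : ∀ {n} {p q : Fin n → Bool} → (∀ i → p i ≡ true → q i ≡ true) → count p ≤ count q
count-mono h = sum-mono λ i → ⟦⟧-mono (h i)

-- Otherwise `q` would be contained in `p`, properly because of `i`, and hence have fewer elements.
exchange : ∀ {n} (p q : Fin n → Bool) → count p ≤ count q →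
           ∀ i → p i ≡ true → q i ≡ false → ∃ λ j → q j ≡ true × p j ≡ false
exchange p q p≤q i pi qi with any? (λ j → q j ∧ not (p j) ≟ᵇ true)
... | yes (j , h) = j , proj₁ (∧-split h) , not-true (proj₂ (∧-split {q j} h))
... | no ¬h = ⊥-elim (<-irrefl refl (<-≤-trans (sum-mono-< q⊆p i strict) p≤q))
  where
  q⊆p : ∀ j → ⟦ q j ⟧ ≤ ⟦ p j ⟧
  q⊆p j with q j in qj | p j in pj
  ... | false | _     = z≤n
  ... | true  | true  = ≤-refl
  ... | true  | false = ⊥-elim (¬h (j , ∧-true qj (cong not pj)))
  strict : ⟦ q i ⟧ < ⟦ p i ⟧
  strict rewrite pi | qi = ≤-refl

-- Kept general in the total preorder so that maxima and minima are two instances of one induction.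
extremum : ∀ {_≼_ : ℕ → ℕ → Set} → (∀ x → x ≼ x) → (∀ {x y z} → x ≼ y → y ≼ z → x ≼ z) →
           (∀ x y → x ≼ y ⊎ y ≼ x) →
           ∀ {n} (p : Fin n → Bool) (f : Fin n → ℕ) →
           (∀ i → p i ≡ false) ⊎ ∃ λ m → p m ≡ true × (∀ i → p i ≡ true → f i ≼ f m)
extremum re tr to {zero}  p f = inj₁ λ ()
extremum re tr to {suc n} p f with p zero in p0 | extremum re tr to (p ∘ suc) (f ∘ suc)
... | false | inj₁ none = inj₁ λ { zero → p0 ; (suc i) → none i }
... | false | inj₂ (m , pm , mx) = inj₂ (suc m , pm , λ { zero h → clash h p0 ; (suc i) h → mx i h })
... | true  | inj₁ none = inj₂ (zero , p0 , λ { zero _ → re _ ; (suc i) h → clash h (none i) })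
... | true  | inj₂ (m , pm , mx) with to (f zero) (f (suc m))
...   | inj₁ l = inj₂ (suc m , pm , λ { zero _ → l ; (suc i) h → mx i h })
...   | inj₂ l = inj₂ (zero , p0 , λ { zero _ → re _ ; (suc i) h → tr (mx i h) l })

argmax : ∀ {n} (p : Fin n → Bool) (f : Fin n → ℕ) →
         (∀ i → p i ≡ false) ⊎ ∃ λ m → p m ≡ true × (∀ i → p i ≡ true → f i ≤ f m)
argmax = extremum {_≤_} (λ _ → ≤-refl) ≤-trans ≤-total

argmin : ∀ {n} (p : Fin n → Bool) (f : Fin n → ℕ) →
         (∀ i → p i ≡ false) ⊎ ∃ λ m → p m ≡ true × (∀ i → p i ≡ true → f m ≤ f i)
argmin = extremum {_≥_} (λ _ → ≤-refl) (λ a b → ≤-trans b a) λ x y → ≤-total y x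

-- Staircases and sums of squares

triangular pyramidal : ℕ → ℕ
triangular zero    = 0
triangular (suc c) = triangular c + suc c
pyramidal zero     = 0
pyramidal (suc c)  = pyramidal c + suc c * suc c

2*triangular : ∀ c → 2 * triangular c ≡ c * suc c
2*triangular zero    = refl
2*triangular (suc c) = begin
  2 * (triangular c + suc c)     ≡⟨ *-distribˡ-+ 2 (triangular c) (suc c) ⟩
  2 * triangular c + 2 * suc c   ≡⟨ cong (_+ 2 * suc c) (2*triangular c) ⟩
  c * suc c + 2 * suc c          ≡⟨ ring c ⟩
  suc c * suc (suc c)            ∎
  where
  open ≡-Reasoning
  ring : ∀ c → c * suc c + 2 * suc c ≡ suc c * suc (suc c)
  ring = solve-∀

cube≤3*pyramidal : ∀ c → c * c * c ≤ 3 * pyramidal c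
cube≤3*pyramidal zero    = z≤n
cube≤3*pyramidal (suc c) = begin
  suc c * suc c * suc c                          ≤⟨ m≤m+n _ (3 * c + 2) ⟩
  suc c * suc c * suc c + (3 * c + 2)            ≡⟨ ring c ⟩
  c * c * c + 3 * (suc c * suc c)                ≤⟨ +-monoˡ-≤ _ (cube≤3*pyramidal c) ⟩
  3 * pyramidal c + 3 * (suc c * suc c)          ≡⟨ *-distribˡ-+ 3 (pyramidal c) _ ⟨
  3 * (pyramidal c + suc c * suc c)              ∎
  where
  open ≤-Reasoning
  ring : ∀ c → suc c * suc c * suc c + (3 * c + 2) ≡ c * c * c + 3 * (suc c * suc c)
  ring = solve-∀

-- After sorting, `t` dominates c, c - 1, ..., 1: its (a+1)-th largest value is at least b + 1 = c -
-- a. Counting the indices above each level avoids the sorting.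
Staircase : ∀ {n} → (Fin n → ℕ) → ℕ → Set
Staircase t c = ∀ a b → suc a + b ≡ c → suc a ≤ count (λ i → b <ᵇ t i)

staircase-pred : ∀ {n} (t : Fin n → ℕ) c → Staircase t (suc c) → Staircase (pred ∘ t) c
staircase-pred t c st a b e =
  ≤-trans (st a (suc b) (trans (+-suc (suc a) b) (cong suc e))) (count-mono λ i → down (t i))
  where
  down : ∀ x → (suc b <ᵇ x) ≡ true → (b <ᵇ pred x) ≡ true
  down (suc x) h = h

-- The lowest layer, formed by the indices of positive value, has at least as many elements as the
-- staircase is high; what lies above it is a staircase of height one less.
staircase-sum : ∀ {n} c (t : Fin n → ℕ) → Staircase t c → triangular c ≤ sum t
staircase-sum zero    t st = z≤n
staircase-sum (suc c) t st = begin
  triangular c + suc c                           ≤⟨ +-mono-≤ (staircase-sum c (pred ∘ t) (staircase-pred t c st)) (st c 0 (+-identityʳ (suc c))) ⟩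
  sum (pred ∘ t) + count (λ i → 0 <ᵇ t i)        ≡⟨ ∑-distrib-+ (pred ∘ t) _ ⟨
  sum (λ i → pred (t i) + ⟦ 0 <ᵇ t i ⟧)          ≡⟨ sum-cong-≗ (λ i → peel (t i)) ⟩
  sum t                                          ∎
  where
  open ≤-Reasoning
  peel : ∀ x → pred x + ⟦ 0 <ᵇ x ⟧ ≡ x
  peel zero    = refl
  peel (suc x) = +-comm x 1

-- The same peeling, now with x² = (x - 1)² + 2(x - 1) + 1 for positive x; `staircase-sum` takes
-- care of the linear term.
staircase-sum² : ∀ {n} c (t : Fin n → ℕ) → Staircase t c → pyramidal c ≤ ∑[ i < n ] (t i * t i)
staircase-sum² zero    t st = z≤n
staircase-sum² {n} (suc c) t st = begin
  pyramidal c + suc c * suc c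
    ≡⟨ cong (pyramidal c +_) (trans (ring c) (cong (_+ suc c) (sym (2*triangular c)))) ⟩
  pyramidal c + (2 * triangular c + suc c)
    ≤⟨ +-mono-≤ (staircase-sum² c t′ st′) (+-mono-≤ (*-monoʳ-≤ 2 (staircase-sum c t′ st′)) (st c 0 (+-identityʳ (suc c)))) ⟩
  sum (λ i → t′ i * t′ i) + (2 * sum t′ + count (λ i → 0 <ᵇ t i))
    ≡⟨ cong (λ z → sum (λ i → t′ i * t′ i) + (z + count (λ i → 0 <ᵇ t i))) (sum-*ˡ 2 t′) ⟨
  sum (λ i → t′ i * t′ i) + (sum (λ i → 2 * t′ i) + count (λ i → 0 <ᵇ t i))
    ≡⟨ cong (sum (λ i → t′ i * t′ i) +_) (∑-distrib-+ (λ i → 2 * t′ i) _) ⟨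
  sum (λ i → t′ i * t′ i) + sum (λ i → 2 * t′ i + ⟦ 0 <ᵇ t i ⟧)
    ≡⟨ ∑-distrib-+ (λ i → t′ i * t′ i) _ ⟨
  sum (λ i → t′ i * t′ i + (2 * t′ i + ⟦ 0 <ᵇ t i ⟧))
    ≡⟨ sum-cong-≗ (λ i → peel (t i)) ⟩
  ∑[ i < n ] (t i * t i) ∎
  where
  open ≤-Reasoning
  t′ : Fin n → ℕ
  t′ i = pred (t i)
  st′ : Staircase t′ c
  st′ = staircase-pred t c st
  ring : ∀ c → suc c * suc c ≡ c * suc c + suc c
  ring = solve-∀
  peel : ∀ x → pred x * pred x + (2 * pred x + ⟦ 0 <ᵇ x ⟧) ≡ x * x
  peel zero    = refl
  peel (suc x) = expand x
    where
    expand : ∀ x → x * x + (2 * x + 1) ≡ suc x * suc x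
    expand = solve-∀

-- Inequalities for the sizes of the parts

2xy+[y∸x]²≤x²+y² : ∀ x y → 2 * (y * x) + (y ∸ x) * (y ∸ x) ≤ x * x + y * y
2xy+[y∸x]²≤x²+y² x y with ≤-total x y
... | inj₁ x≤y with m≤n⇒∃[o]m+o≡n x≤y
...   | o , refl rewrite m+n∸m≡n x o = ≤-reflexive (ring x o)
  where
  ring : ∀ x o → 2 * ((x + o) * x) + o * o ≡ x * x + (x + o) * (x + o)
  ring = solve-∀
2xy+[y∸x]²≤x²+y² x y | inj₂ y≤x with m≤n⇒∃[o]m+o≡n y≤x
...   | o , refl rewrite m≤n⇒m∸n≡0 (m≤m+n y o) = m+n≤o⇒m≤o _ (≤-reflexive (ring y o))
  where
  ring : ∀ y o → 2 * (y * (y + o)) + 0 + o * o ≡ (y + o) * (y + o) + y * y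
  ring = solve-∀

-- The two sides differ by (y - x)(n - x - y).
x≤y⇒x[n∸x]≤y[n∸y] : ∀ {n x y} → x ≤ y → x + y ≤ n → x * (n ∸ x) ≤ y * (n ∸ y)
x≤y⇒x[n∸x]≤y[n∸y] {n} {x} {y} x≤y x+y≤n with m≤n⇒∃[o]m+o≡n x≤y
... | o , refl with m≤n⇒∃[o]m+o≡n x+y≤n
...   | s , refl = begin
  x * (x + (x + o) + s ∸ x)                      ≡⟨ cong (λ z → x * (z ∸ x)) (ring₁ x o s) ⟩
  x * (x + (x + o + s) ∸ x)                      ≡⟨ cong (x *_) (m+n∸m≡n x _) ⟩
  x * (x + o + s)                                ≤⟨ m≤m+n _ (o * s) ⟩
  x * (x + o + s) + o * s                        ≡⟨ ring₂ x o s ⟩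
  (x + o) * (x + s)                              ≡⟨ cong ((x + o) *_) (m+n∸m≡n (x + o) _) ⟨
  (x + o) * (x + o + (x + s) ∸ (x + o))          ≡⟨ cong (λ z → (x + o) * (z ∸ (x + o))) (ring₃ x o s) ⟩
  (x + o) * (x + (x + o) + s ∸ (x + o))          ∎
  where
  open ≤-Reasoning
  ring₁ : ∀ x o s → x + (x + o) + s ≡ x + (x + o + s)
  ring₁ = solve-∀
  ring₂ : ∀ x o s → x * (x + o + s) + o * s ≡ (x + o) * (x + s)
  ring₂ = solve-∀
  ring₃ : ∀ x o s → x + o + (x + s) ≡ x + (x + o) + s
  ring₃ = solve-∀

-- With ν = δ + y, this bounds the total cut if one part has ν + δ vertices and each of the other ν
-- + y vertices contributes at most y(3ν - y). The difference of the sides is a polynomial with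
-- nonnegative coefficients.
two-large-parts : ∀ δ y →
  (δ + y + δ) * ((δ + y + δ) * (δ + 2 * y)) + (δ + 2 * y) * (y * (3 * δ + 2 * y))
  ≤ 6 * ((δ + y) * (δ + y) * (δ + y))
two-large-parts δ y = m+n≤o⇒m≤o _ (≤-reflexive (ring δ y))
  where
  ring : ∀ δ y →
    (δ + y + δ) * ((δ + y + δ) * (δ + 2 * y)) + (δ + 2 * y) * (y * (3 * δ + 2 * y))
    + (2 * (δ * δ * δ) + 3 * (δ * δ * y) + δ * y * y)
    ≡ 6 * ((δ + y) * (δ + y) * (δ + y))
  ring = solve-∀

-- Writing X = ν + δ, Y = ν + η, r = ν − δ − η, the left-hand side is 6ν³ + 3δη(δ + η).
three-parts : ∀ X Y r ν V → X + Y + r ≡ 3 * ν → r ≤ ν → ν ≤ X →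
  (∀ c → r + c ≡ ν → c ≤ Y → pyramidal c ≤ V) →
  X * (X * (Y + r)) + (Y * (Y * (X + r)) + r * (r * (X + Y))) ≤ 6 * (ν * ν * ν) + 3 * V
three-parts X Y r ν V sum≡ r≤ν ν≤X hV with ≤-total Y ν
-- Here η = -e is not positive, while δ = c + e and δ + η = c are not negative, so 3δη(δ + η) is at
-- most 0.
... | inj₁ Y≤ν = ≤-trans (small (m≤n⇒∃[o]m+o≡n Y≤ν) (m≤n⇒∃[o]m+o≡n r≤ν)) (m≤m+n _ _)
  where
  small : (∃ λ e → Y + e ≡ ν) → (∃ λ c → r + c ≡ ν) →
          X * (X * (Y + r)) + (Y * (Y * (X + r)) + r * (r * (X + Y))) ≤ 6 * (ν * ν * ν)
  small (e , Ye) (c , rc) with X≡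
    where
    X≡ : X ≡ ν + (c + e)
    X≡ = +-cancelʳ-≡ (Y + r) X _ (trans (sym (+-assoc X Y r)) (trans sum≡
           (trans (cong (ν +_) (cong₂ _+_ (sym Ye) (trans (+-identityʳ ν) (sym rc)))) (ring ν Y e r c))))
      where
      ring : ∀ ν Y e r c → ν + (Y + e + (r + c)) ≡ ν + (c + e) + (Y + r)
      ring = solve-∀
  -- Comparing r with Y writes one of c and e as the other plus t, so that every quantity becomes a
  -- sum of free variables.
  ... | refl with ≤-total r Y
  ...   | inj₁ r≤Y with m≤n⇒∃[o]m+o≡n r≤Y
  ...     | t , refl with +-cancelˡ-≡ r c (t + e) (trans rc (trans (sym Ye) (+-assoc r t e)))
  ...       | refl rewrite sym Ye = m+n≤o⇒m≤o _ (≤-reflexive (ring r t e))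
    where
    ring : ∀ r t e →
      (r + t + e + (t + e + e)) * ((r + t + e + (t + e + e)) * (r + t + r))
      + ((r + t) * ((r + t) * (r + t + e + (t + e + e) + r))
         + r * (r * (r + t + e + (t + e + e) + (r + t))))
      + 3 * ((t + e + e) * e * (t + e))
      ≡ 6 * ((r + t + e) * (r + t + e) * (r + t + e))
    ring = solve-∀
  small (e , Ye) (c , rc) | refl | inj₂ Y≤r with m≤n⇒∃[o]m+o≡n Y≤r
  ...     | t , refl with +-cancelˡ-≡ Y e (t + c) (trans Ye (trans (sym rc) (+-assoc Y t c)))
  ...       | refl rewrite sym Ye = m+n≤o⇒m≤o _ (≤-reflexive (ring Y t c))
    where
    ring : ∀ Y t c →
      (Y + (t + c) + (c + (t + c))) * ((Y + (t + c) + (c + (t + c))) * (Y + (Y + t)))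
      + (Y * (Y * (Y + (t + c) + (c + (t + c)) + (Y + t)))
         + (Y + t) * ((Y + t) * (Y + (t + c) + (c + (t + c)) + Y)))
      + 3 * ((c + (t + c)) * c * (t + c))
      ≡ 6 * ((Y + (t + c)) * (Y + (t + c)) * (Y + (t + c)))
    ring = solve-∀
three-parts X Y r ν V sum≡ r≤ν ν≤X hV | inj₂ ν≤Y
  with m≤n⇒∃[o]m+o≡n ν≤X | m≤n⇒∃[o]m+o≡n ν≤Y
... | δ , refl | η , refl with +-cancelˡ-≡ (2 * ν) (r + (δ + η)) ν (trans (ring ν r δ η) (trans sum≡ (ring′ ν)))
  where
  ring : ∀ ν r δ η → 2 * ν + (r + (δ + η)) ≡ ν + δ + (ν + η) + r
  ring = solve-∀
  ring′ : ∀ ν → 3 * ν ≡ 2 * ν + ν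
  ring′ = solve-∀
...   | refl = begin
  _                                                        ≡⟨ ring r δ η ⟩
  6 * (μ * μ * μ) + 3 * (δ * η * (δ + η))                  ≤⟨ +-monoʳ-≤ (6 * (μ * μ * μ)) bound ⟩
  6 * (μ * μ * μ) + 3 * V                                  ∎
  where
  open ≤-Reasoning
  μ : ℕ
  μ = r + (δ + η)
  ring : ∀ r δ η → let X = r + (δ + η) + δ ; Y = r + (δ + η) + η in
    X * (X * (Y + r)) + (Y * (Y * (X + r)) + r * (r * (X + Y)))
    ≡ 6 * ((r + (δ + η)) * (r + (δ + η)) * (r + (δ + η))) + 3 * (δ * η * (δ + η))
  ring = solve-∀
  ring₂ : ∀ δ η → (δ + η) * (δ + η) * (δ + η)
    ≡ 3 * (δ * η * (δ + η)) + (δ * δ * δ + η * η * η)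
  ring₂ = solve-∀
  -- With c = δ + η, the cube c³ exceeds 3δηc by δ³ + η³ and is at most 3(1² + ... + c²).
  bound : 3 * (δ * η * (δ + η)) ≤ 3 * V
  bound = begin
    3 * (δ * η * (δ + η))                                  ≤⟨ m≤m+n _ _ ⟩
    3 * (δ * η * (δ + η)) + (δ * δ * δ + η * η * η)        ≡⟨ ring₂ δ η ⟨
    (δ + η) * (δ + η) * (δ + η)                            ≤⟨ cube≤3*pyramidal (δ + η) ⟩
    3 * pyramidal (δ + η)                                  ≤⟨ *-monoʳ-≤ 3 (hV (δ + η) refl
                                                                (≤-trans (m≤n+m (δ + η) r) (m≤m+n _ η))) ⟩
    3 * V                                                  ∎

-- Oriented complete multipartite graphs

≡false : ∀ {b} → b ≢ true → b ≡ false
≡false {false} h = refl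
≡false {true}  h = ⊥-elim (h refl)

not-false : ∀ {b} → b ≡ false → not b ≡ true
not-false refl = refl

≤⇒<ᵇ : ∀ {m n} → m < n → (m <ᵇ n) ≡ true
≤⇒<ᵇ {zero}  (s≤s _) = refl
≤⇒<ᵇ {suc m} (s≤s l) = ≤⇒<ᵇ l

<ᵇ-true : ∀ {m n} → (m <ᵇ n) ≡ true → m < n
<ᵇ-true {zero}  {suc n} h = s≤s z≤n
<ᵇ-true {suc m} {suc n} h = s≤s (<ᵇ-true h)

-- Oriented complete multipartite graphs: eq is the relation of lying in the same part.
module Multipartite {n : ℕ} (eq to : Fin n → Fin n → Bool)
  (eq-refl  : ∀ i → eq i i ≡ true)
  (eq-sym   : ∀ i j → eq i j ≡ true → eq j i ≡ true)
  (eq-trans : ∀ i j k → eq i j ≡ true → eq j k ≡ true → eq i k ≡ true)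
  (oriented : ∀ i j → ⟦ eq i j ⟧ + (⟦ to i j ⟧ + ⟦ to j i ⟧) ≡ 1)
  (no-C₄    : ∀ a a′ b b′ → eq a a′ ≡ true → eq b b′ ≡ true →
              to a b ≡ true → to b a′ ≡ true → to a′ b′ ≡ true → to b′ a ≡ true → ⊥)
  where

  size out : Fin n → ℕ
  size i = count (eq i)
  out i  = count (to i)

  eq-class : ∀ i j → eq i j ≡ true → ∀ k → eq i k ≡ eq j k
  eq-class i j ij k with eq i k in ik | eq j k in jk
  ... | true  | true  = refl
  ... | false | false = refl
  ... | true  | false = sym (trans (sym jk) (eq-trans j i k (eq-sym i j ij) ik))
  ... | false | true  = trans (sym ik) (eq-trans i j k ij jk)

  size-class : ∀ i j → eq i j ≡ true → size i ≡ size j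
  size-class i j ij = sum-cong-≗ λ k → cong ⟦_⟧ (eq-class i j ij k)

  to⇒¬eq : ∀ i j → to i j ≡ true → eq i j ≡ false
  to⇒¬eq i j ij with oriented i j
  ... | h rewrite ij with eq i j
  ...   | false = refl
  ...   | true  = case h of λ ()

  to⇒¬ot : ∀ i j → to i j ≡ true → to j i ≡ false
  to⇒¬ot i j ij with oriented i j | to⇒¬eq i j ij
  ... | h | e rewrite ij | e with to j i
  ...   | false = refl
  ...   | true  = case h of λ ()

  ¬eq⇒to : ∀ i j → eq i j ≡ false → to i j ≡ false → to j i ≡ true
  ¬eq⇒to i j e ij with oriented i j
  ... | h rewrite e | ij with to j i
  ...   | true  = refl
  ...   | false = case h of λ ()

  -- Sum `oriented` over all ordered pairs of vertices: every arrow is met once from each of its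
  -- ends.
  handshake : sum size + 2 * sum out ≡ n * n
  handshake = begin
    sum size + 2 * sum out
      ≡⟨ cong (λ z → sum size + (sum out + z)) (trans (+-identityʳ _) (∑-comm λ i j → ⟦ to i j ⟧)) ⟩
    sum size + (sum out + sum (λ i → count (λ j → to j i)))
      ≡⟨ cong (sum size +_) (∑-distrib-+ out _) ⟨
    sum size + sum (λ i → out i + count (λ j → to j i))
      ≡⟨ ∑-distrib-+ size _ ⟨
    sum (λ i → size i + (out i + count (λ j → to j i)))
      ≡⟨ sum-cong-≗ (λ i → trans (cong (size i +_) (sym (∑-distrib-+ (λ j → ⟦ to i j ⟧) _))) (sym (∑-distrib-+ (λ j → ⟦ eq i j ⟧) _))) ⟩
    sum (λ i → sum (λ j → ⟦ eq i j ⟧ + (⟦ to i j ⟧ + ⟦ to j i ⟧)))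
      ≡⟨ sum-cong-≗ (λ i → trans (sum-cong-≗ (oriented i)) (trans (sum-const n 1) (*-identityʳ n))) ⟩
    sum {n} (λ i → n)
      ≡⟨ sum-const n n ⟩
    n * n ∎
    where open ≡-Reasoning

  rest : Fin n → Fin n → Fin n → Bool
  rest p q i = not (eq p i) ∧ not (eq q i)

  fan : Fin n → Fin n → ℕ
  fan q i = count (λ j → eq q j ∧ to i j)

  -- No arrow stays inside the part of `i`, which is that of `p`; so whatever `i` dominates outside
  -- the part of `q` lies in the rest.
  out≤fan+rest : ∀ p q i → eq p i ≡ true → out i ≤ fan q i + count (rest p q)
  out≤fan+rest p q i pi = begin
    out i                                                     ≤⟨ sum-mono pointwise ⟩
    sum (λ j → ⟦ eq q j ∧ to i j ⟧ + ⟦ rest p q j ⟧)          ≡⟨ ∑-distrib-+ (λ j → ⟦ eq q j ∧ to i j ⟧) _ ⟩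
    fan q i + count (rest p q)                                ∎
    where
    open ≤-Reasoning
    pointwise : ∀ j → ⟦ to i j ⟧ ≤ ⟦ eq q j ∧ to i j ⟧ + ⟦ rest p q j ⟧
    pointwise j with to i j in ij
    ... | false = z≤n
    ... | true rewrite trans (eq-class p i pi j) (to⇒¬eq i j ij) with eq q j
    ...   | true  = ≤-refl
    ...   | false = ≤-refl

  -- A vertex of either part dominates at most r vertices outside the other one. If it dominates at
  -- most a vertices of the other part, its deficit therefore exceeds b. To find a + 1 such
  -- vertices, look in the part of `p`; if there are too few, take the vertices of the other part
  -- that a suitable vertex of the first dominates.
  staircase : ∀ p q ν c → eq p q ≡ false → count (rest p q) + c ≡ ν → c ≤ size p →
              Staircase (λ i → ν ∸ out i) c
  staircase p q ν c pq refl c≤X a b refl = by-cases (suc a ≤? count lowP)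
    where
    r : ℕ
    r = count (rest p q)
    lowP highP lowQ low : Fin n → Bool
    lowP i  = eq p i ∧ (fan q i <ᵇ suc a)
    highP i = eq p i ∧ (a <ᵇ fan q i)
    lowQ i  = eq q i ∧ (fan p i <ᵇ suc a)
    low i   = b <ᵇ (r + (suc a + b) ∸ out i)

    is-low : ∀ p′ q′ i → eq p′ i ≡ true → fan q′ i ≤ a → count (rest p′ q′) ≡ r → low i ≡ true
    is-low p′ q′ i pi f e = ≤⇒<ᵇ (m+n≤o⇒m≤o∸n (suc b) (begin
      suc b + out i                            ≤⟨ +-monoʳ-≤ (suc b) (out≤fan+rest p′ q′ i pi) ⟩
      suc b + (fan q′ i + count (rest p′ q′))  ≡⟨ cong (λ z → suc b + (fan q′ i + z)) e ⟩
      suc b + (fan q′ i + r)                   ≤⟨ +-monoʳ-≤ (suc b) (+-monoˡ-≤ r f) ⟩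
      suc b + (a + r)                          ≡⟨ ring a r b ⟩
      r + (suc a + b)                          ∎))
      where
      open ≤-Reasoning
      ring : ∀ a r b → suc b + (a + r) ≡ r + (suc a + b)
      ring = solve-∀

    rest-comm : count (rest q p) ≡ r
    rest-comm = sum-cong-≗ λ i → cong ⟦_⟧ (∧-comm (not (eq q i)) (not (eq p i)))

    -- A vertex a₀ of the part of p with the least out-degree above a into the part of q:
    -- by no-C₄, every vertex above it dominates all its out-neighbours there.
    from-least : ¬ suc a ≤ count lowP → ∀ a₀ → highP a₀ ≡ true →
                 (∀ i → highP i ≡ true → fan q a₀ ≤ fan q i) → suc a ≤ count low
    from-least few a₀ h₀ least = begin
      suc a         ≤⟨ <ᵇ-true (proj₂ (∧-split {eq p a₀} h₀)) ⟩
      fan q a₀      ≤⟨ count-mono (λ i h → ∧-true (proj₁ (∧-split {eq q i} h)) (≤⇒<ᵇ (dominated i h))) ⟩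
      count lowQ    ≤⟨ count-mono (λ i h → let (qi , f) = ∧-split {eq q i} h in
                         is-low q p i qi (s≤s⁻¹ (<ᵇ-true f)) rest-comm) ⟩
      count low     ∎
      where
      open ≤-Reasoning
      pa₀ : eq p a₀ ≡ true
      pa₀ = proj₁ (∧-split {eq p a₀} h₀)
      crossing : ∀ x y → eq p x ≡ true → eq q y ≡ true → eq x y ≡ false
      crossing x y px qy = ≡false λ xy →
        clash (eq-trans p y q (eq-trans p x y px xy) (eq-sym q y qy)) pq
      dominated : ∀ i → eq q i ∧ to a₀ i ≡ true → fan p i < suc a
      dominated i h = ≤-<-trans (count-mono in-low) (≰⇒> few)
        where
        qi : eq q i ≡ true
        qi = proj₁ (∧-split {eq q i} h)
        a₀i : to a₀ i ≡ true
        a₀i = proj₂ (∧-split {eq q i} h)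
        in-low : ∀ x → eq p x ∧ to i x ≡ true → lowP x ≡ true
        in-low x g with ∧-split {eq p x} g
        ... | px , ix with fan q x <? suc a
        ...   | yes l = ∧-true px (≤⇒<ᵇ l)
        -- If `x` were above level `a`, it would dominate at least as many vertices of the part of
        -- `q` as `a₀` does, but not `i`. So it dominates some `j` that `a₀` does not, and a₀ → i →
        -- x → j → a₀ is a forbidden cycle.
        ...   | no ¬l with exchange (λ j → eq q j ∧ to a₀ j) (λ j → eq q j ∧ to x j)
                             (least x (∧-true px (≤⇒<ᵇ (≮⇒≥ ¬l))))
                             i h (≡false λ e → clash (proj₂ (∧-split {eq q i} e)) (to⇒¬ot i x ix))
        ...     | j , qx , ¬qa with ∧-split {eq q j} qx
        ...       | qj , xj = ⊥-elim (no-C₄ a₀ x i j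
                      (eq-trans a₀ p x (eq-sym p a₀ pa₀) px) (eq-trans i q j (eq-sym q i qi) qj)
                      a₀i ix xj (¬eq⇒to a₀ j (crossing a₀ j pa₀ qj)
                                  (≡false λ e → clash (∧-true qj e) ¬qa)))

    by-cases : Dec (suc a ≤ count lowP) → suc a ≤ count low
    by-cases (yes enough) = ≤-trans enough (count-mono λ i h →
      let (pi , f) = ∧-split {eq p i} h in is-low p q i pi (s≤s⁻¹ (<ᵇ-true f)) refl)
    by-cases (no few) with argmin highP (fan q)
    ... | inj₂ (a₀ , h₀ , least) = from-least few a₀ h₀ least
    -- With nothing above level `a`, the whole part of `p` is low, and it has at least c ≥ a + 1
    -- vertices.
    ... | inj₁ none = ⊥-elim (few (≤-trans (m+n≤o⇒m≤o (suc a) c≤X) (count-mono λ i pi →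
          ∧-true pi (≤⇒<ᵇ {fan q i} (s≤s (≮⇒≥ λ l → clash (∧-true pi (≤⇒<ᵇ l)) (none i)))))))

  three-classes : ∀ p q → eq p q ≡ false → ∀ i → ⟦ eq p i ⟧ + (⟦ eq q i ⟧ + ⟦ rest p q i ⟧) ≡ 1
  three-classes p q pq i with eq p i in pi | eq q i in qi
  ... | true  | true  = clash (eq-trans p i q pi (eq-sym q i qi)) pq
  ... | true  | false = refl
  ... | false | true  = refl
  ... | false | false = refl

  sum-three : ∀ p q (w : Fin n → ℕ) A B C →
              (∀ i → w i ≤ ⟦ eq p i ⟧ * A + (⟦ eq q i ⟧ * B + ⟦ rest p q i ⟧ * C)) →
              sum w ≤ size p * A + (size q * B + count (rest p q) * C)
  sum-three p q w A B C h = begin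
    sum w
      ≤⟨ sum-mono h ⟩
    sum (λ i → ⟦ eq p i ⟧ * A + (⟦ eq q i ⟧ * B + ⟦ rest p q i ⟧ * C))
      ≡⟨ ∑-distrib-+ (λ i → ⟦ eq p i ⟧ * A) _ ⟩
    sum (λ i → ⟦ eq p i ⟧ * A) + sum (λ i → ⟦ eq q i ⟧ * B + ⟦ rest p q i ⟧ * C)
      ≡⟨ cong₂ _+_ (sum-*ʳ (λ i → ⟦ eq p i ⟧) A)
           (trans (∑-distrib-+ (λ i → ⟦ eq q i ⟧ * B) _)
             (cong₂ _+_ (sum-*ʳ (λ i → ⟦ eq q i ⟧) B) (sum-*ʳ (λ i → ⟦ rest p q i ⟧) C))) ⟩
    size p * A + (size q * B + count (rest p q) * C) ∎
    where open ≤-Reasoning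

  sizes-sum : ∀ p q → eq p q ≡ false → size p + (size q + count (rest p q)) ≡ n
  sizes-sum p q pq = begin
    size p + (size q + count (rest p q))
      ≡⟨ cong (size p +_) (∑-distrib-+ (λ i → ⟦ eq q i ⟧) _) ⟨
    size p + sum (λ i → ⟦ eq q i ⟧ + ⟦ rest p q i ⟧)
      ≡⟨ ∑-distrib-+ (λ i → ⟦ eq p i ⟧) _ ⟨
    sum (λ i → ⟦ eq p i ⟧ + (⟦ eq q i ⟧ + ⟦ rest p q i ⟧))
      ≡⟨ sum-cong-≗ (three-classes p q pq) ⟩
    sum {n} (λ _ → 1)
      ≡⟨ trans (sum-const n 1) (*-identityʳ n) ⟩
    n ∎
    where open ≡-Reasoning

  module _ (ν : ℕ) (n≡3ν : n ≡ 3 * ν) where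

    cut : Fin n → ℕ
    cut i = size i * (n ∸ size i)

    -- Because of the truncated subtraction only vertices of out-degree below ν contribute; these
    -- are the ones that `staircase` provides.
    deficit² : ℕ
    deficit² = sum (λ i → (ν ∸ out i) * (ν ∸ out i))

    -- Raising every size to ν can only increase x(3ν - x), as the two sizes compared add up to at
    -- most 3ν.
    all-small : (∀ i → size i ≤ ν) → sum cut ≤ 6 * (ν * ν * ν)
    all-small small = begin
      sum cut                      ≤⟨ sum-mono (λ i → x≤y⇒x[n∸x]≤y[n∸y] (small i) (fits i)) ⟩
      sum {n} (λ _ → ν * (n ∸ ν))  ≡⟨ sum-const n _ ⟩
      n * (ν * (n ∸ ν))            ≡⟨ cong₂ (λ x y → x * (ν * y)) n≡3ν (trans (cong (_∸ ν) n≡3ν) (m+n∸m≡n ν (2 * ν))) ⟩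
      3 * ν * (ν * (2 * ν))        ≡⟨ ring ν ⟩
      6 * (ν * ν * ν)              ∎
      where
      open ≤-Reasoning
      ring : ∀ ν → 3 * ν * (ν * (2 * ν)) ≡ 6 * (ν * ν * ν)
      ring = solve-∀
      fits : ∀ i → size i + ν ≤ n
      fits i = subst (size i + ν ≤_) (sym n≡3ν) (+-mono-≤ (small i) (m≤m+n ν _))

    -- Next to the largest part, that of `p`, consider the largest of the others, that of `q`;
    -- without others all cuts vanish. With r vertices outside both, the case r ≤ ν leads to
    -- `three-parts` and the case r ≥ ν to `two-large-parts`.
    big-part : ∀ p → ν < size p → (∀ i → size i ≤ size p) →
               sum cut ≤ 6 * (ν * ν * ν) + 3 * deficit²
    big-part p ν<X max with argmax (λ i → not (eq p i)) size
    ... | inj₁ one = ≤-trans (sum-mono {g = λ _ → 0} λ i → ≤-reflexive (uncut i))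
                       (≤-trans (≤-reflexive (trans (sum-const n 0) (*-zeroʳ n))) z≤n)
      where
      all-p : ∀ i → eq p i ≡ true
      all-p i with eq p i | one i
      ... | true | _ = refl
      uncut : ∀ i → cut i ≡ 0
      uncut i rewrite sym (size-class p i (all-p i)) | count-all (eq p) all-p | n∸n≡0 n = *-zeroʳ n
    ... | inj₂ (q , ¬pq , max-q) = by-rest (≤-total r ν)
      where
      open ≤-Reasoning
      X Y r : ℕ
      X = size p
      Y = size q
      r = count (rest p q)
      pq : eq p q ≡ false
      pq = not-true ¬pq
      X+Y+r≡n : X + (Y + r) ≡ n
      X+Y+r≡n = sizes-sum p q pq
      rest-size : ∀ i → eq p i ≡ false → eq q i ≡ false → size i ≤ r
      rest-size i pi qi = count-mono λ j ij → ∧-true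
        (not-false (≡false λ pj → clash (eq-trans p j i pj (eq-sym i j ij)) pi))
        (not-false (≡false λ qj → clash (eq-trans q j i qj (eq-sym i j ij)) qi))
      cut-p : X * (n ∸ X) ≡ X * (Y + r)
      cut-p = cong (X *_) (trans (cong (_∸ X) (sym X+Y+r≡n)) (m+n∸m≡n X _))

      by-class : ∀ B C → Y * (n ∸ Y) ≤ B → (∀ i → eq p i ≡ false → eq q i ≡ false → cut i ≤ C) →
                 ∀ i → cut i ≤ ⟦ eq p i ⟧ * (X * (Y + r)) + (⟦ eq q i ⟧ * B + ⟦ rest p q i ⟧ * C)
      by-class B C hB hC i with eq p i in pi | eq q i in qi
      ... | true  | _ rewrite sym (size-class p i pi) =
        ≤-trans (≤-reflexive (trans cut-p (sym (+-identityʳ _)))) (m≤m+n _ _)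
      ... | false | true rewrite sym (size-class q i qi) =
        ≤-trans (≤-trans hB (≤-reflexive (sym (+-identityʳ B)))) (m≤m+n _ _)
      ... | false | false = ≤-trans (hC i pi qi) (≤-reflexive (sym (+-identityʳ C)))

      -- The remaining parts are treated as a single part of r vertices, which can only increase
      -- their cuts since r ≤ ν.
      small-rest : r ≤ ν → sum cut ≤ 6 * (ν * ν * ν) + 3 * deficit²
      small-rest r≤ν = begin
        sum cut
          ≤⟨ sum-three p q cut (X * (Y + r)) (Y * (X + r)) (r * (X + Y)) (by-class _ _ (≤-reflexive cut-q) cut-r) ⟩
        X * (X * (Y + r)) + (Y * (Y * (X + r)) + r * (r * (X + Y)))
          ≤⟨ three-parts X Y r ν deficit² (trans (+-assoc X Y r) (trans X+Y+r≡n n≡3ν)) r≤ν (<⇒≤ ν<X)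
               (λ c e c≤Y → staircase-sum² c (λ i → ν ∸ out i)
                 (staircase p q ν c pq e (≤-trans c≤Y (max q)))) ⟩
        6 * (ν * ν * ν) + 3 * deficit² ∎
        where
        swap : ∀ X Y r → Y + (X + r) ≡ X + (Y + r)
        swap = solve-∀
        swap′ : ∀ X Y r → r + (X + Y) ≡ X + (Y + r)
        swap′ = solve-∀
        cut-q : Y * (n ∸ Y) ≡ Y * (X + r)
        cut-q = cong (Y *_) (trans (cong (_∸ Y) (trans (sym X+Y+r≡n) (sym (swap X Y r)))) (m+n∸m≡n Y _))
        cut-r : ∀ i → eq p i ≡ false → eq q i ≡ false → cut i ≤ r * (X + Y)
        cut-r i pi qi = begin
          cut i            ≤⟨ x≤y⇒x[n∸x]≤y[n∸y] (rest-size i pi qi) fits ⟩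
          r * (n ∸ r)      ≡⟨ cong (r *_) (trans (cong (_∸ r) (trans (sym X+Y+r≡n) (sym (swap′ X Y r)))) (m+n∸m≡n r _)) ⟩
          r * (X + Y)      ∎
          where
          fits : size i + r ≤ n
          fits = begin
            size i + r     ≤⟨ +-mono-≤ (≤-trans (rest-size i pi qi) r≤ν) (≤-trans r≤ν (m≤m+n ν _)) ⟩
            3 * ν          ≡⟨ n≡3ν ⟨
            n              ∎

      -- Writing X = ν + δ, the bound r ≥ ν forces Y ≤ ν - δ = y. Every vertex outside the part of
      -- `p` is treated as lying in a part of y vertices.
      large-rest : ν ≤ r → sum cut ≤ 6 * (ν * ν * ν) + 3 * deficit²
      large-rest ν≤r with m≤n⇒∃[o]m+o≡n (<⇒≤ ν<X)
      ... | δ , ν+δ≡X with m≤n⇒∃[o]m+o≡n δ+Y≤ν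
        where
        δ+Y≤ν : δ + Y ≤ ν
        δ+Y≤ν = +-cancelˡ-≤ (ν + ν) _ _ (begin
          ν + ν + (δ + Y)   ≡⟨ ring ν δ Y ⟩
          ν + δ + (Y + ν)   ≤⟨ +-mono-≤ (≤-reflexive ν+δ≡X) (+-monoʳ-≤ Y ν≤r) ⟩
          X + (Y + r)       ≡⟨ trans X+Y+r≡n n≡3ν ⟩
          3 * ν             ≡⟨ ring′ ν ⟩
          ν + ν + ν         ∎)
          where
          ring : ∀ ν δ Y → ν + ν + (δ + Y) ≡ ν + δ + (Y + ν)
          ring = solve-∀
          ring′ : ∀ ν → 3 * ν ≡ ν + ν + ν
          ring′ = solve-∀
      ...   | o , δ+Y+o≡ν = begin
        sum cut
          ≤⟨ sum-three p q cut (X * (Y + r)) _ _ (by-class (y * (3 * δ + 2 * y)) (y * (3 * δ + 2 * y))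
               (cut≤ q pq) (λ i pi _ → cut≤ i pi)) ⟩
        X * (X * (Y + r)) + (Y * (y * (3 * δ + 2 * y)) + r * (y * (3 * δ + 2 * y)))
          ≡⟨ cong (X * (X * (Y + r)) +_) (sym (*-distribʳ-+ (y * (3 * δ + 2 * y)) Y r)) ⟩
        X * (X * (Y + r)) + (Y + r) * (y * (3 * δ + 2 * y))
          ≡⟨ cong₂ (λ x z → x * (x * z) + z * (y * (3 * δ + 2 * y))) X≡ Y+r≡ ⟩
        (δ + y + δ) * ((δ + y + δ) * (δ + 2 * y)) + (δ + 2 * y) * (y * (3 * δ + 2 * y))
          ≤⟨ two-large-parts δ y ⟩
        6 * ((δ + y) * (δ + y) * (δ + y))
          ≡⟨ cong (λ z → 6 * (z * z * z)) ν≡ ⟩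
        6 * (ν * ν * ν)
          ≤⟨ m≤m+n _ _ ⟩
        6 * (ν * ν * ν) + 3 * deficit² ∎
        where
        y : ℕ
        y = Y + o
        ν≡ : δ + y ≡ ν
        ν≡ = trans (sym (+-assoc δ Y o)) δ+Y+o≡ν
        X≡ : X ≡ δ + y + δ
        X≡ = trans (sym ν+δ≡X) (cong (_+ δ) (sym ν≡))
        n≡ : n ≡ 3 * (δ + y)
        n≡ = trans n≡3ν (cong (3 *_) (sym ν≡))
        Y+r≡ : Y + r ≡ δ + 2 * y
        Y+r≡ = +-cancelˡ-≡ (δ + y + δ) _ _
          (trans (cong (_+ (Y + r)) (sym X≡)) (trans X+Y+r≡n (trans n≡ (ring δ y))))
          where
          ring : ∀ δ y → 3 * (δ + y) ≡ δ + y + δ + (δ + 2 * y)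
          ring = solve-∀
        cut≤ : ∀ i → eq p i ≡ false → cut i ≤ y * (3 * δ + 2 * y)
        cut≤ i pi = begin
          cut i                        ≤⟨ x≤y⇒x[n∸x]≤y[n∸y] size≤y fits ⟩
          y * (n ∸ y)                  ≡⟨ cong (y *_) (trans (cong (_∸ y) (trans n≡ (ring δ y))) (m+n∸m≡n y _)) ⟩
          y * (3 * δ + 2 * y)          ∎
          where
          ring : ∀ δ y → 3 * (δ + y) ≡ y + (3 * δ + 2 * y)
          ring = solve-∀
          ring′ : ∀ δ y → y + y + (3 * δ + y) ≡ 3 * (δ + y)
          ring′ = solve-∀
          size≤y : size i ≤ y
          size≤y = ≤-trans (max-q i (not-false pi)) (m≤m+n Y o)
          fits : size i + y ≤ n
          fits = begin
            size i + y             ≤⟨ +-monoˡ-≤ y size≤y ⟩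
            y + y                  ≤⟨ m≤m+n _ _ ⟩
            y + y + (3 * δ + y)    ≡⟨ trans (ring′ δ y) (sym n≡) ⟩
            n                      ∎

      by-rest : r ≤ ν ⊎ ν ≤ r → sum cut ≤ 6 * (ν * ν * ν) + 3 * deficit²
      by-rest (inj₁ r≤ν) = small-rest r≤ν
      by-rest (inj₂ ν≤r) = large-rest ν≤r

    cut-bound : sum cut ≤ 6 * (ν * ν * ν) + 3 * deficit²
    cut-bound with argmax (λ _ → true) size
    ... | inj₁ none = ≤-trans (all-small λ i → ⊥-elim (true≢false (none i))) (m≤m+n _ _)
    ... | inj₂ (p , _ , max) with size p ≤? ν
    ...   | yes X≤ν = ≤-trans (all-small λ i → ≤-trans (max i refl) X≤ν) (m≤m+n _ _)
    ...   | no X≰ν  = big-part p (≰⇒> X≰ν) (λ i → max i refl)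

    cut+size² : sum cut + sum (λ i → size i * size i) ≡ n * sum size
    cut+size² = begin
      sum cut + sum (λ i → size i * size i)      ≡⟨ ∑-distrib-+ cut _ ⟨
      sum (λ i → cut i + size i * size i)        ≡⟨ sum-cong-≗ (λ i → trans (sym (*-distribˡ-+ (size i) _ _))
                                                     (trans (cong (size i *_) (m∸n+n≡m (size≤n i))) (*-comm (size i) n))) ⟩
      sum (λ i → n * size i)                     ≡⟨ sum-*ˡ n size ⟩
      n * sum size                               ∎
      where
      open ≡-Reasoning
      size≤n : ∀ i → size i ≤ n
      size≤n i = ≤-trans (sum-mono λ j → ⟦⟧≤1 (eq i j)) (≤-reflexive (trans (sum-const n 1) (*-identityʳ n)))

    deficit-bound : 2 * (ν * sum out) + deficit² ≤ sum (λ i → out i * out i) + n * (ν * ν)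
    deficit-bound = begin
      2 * (ν * sum out) + deficit²
        ≡⟨ cong (_+ deficit²) (trans (cong (2 *_) (sym (sum-*ˡ ν out))) (sym (sum-*ˡ 2 (λ i → ν * out i)))) ⟩
      sum (λ i → 2 * (ν * out i)) + deficit²
        ≡⟨ ∑-distrib-+ (λ i → 2 * (ν * out i)) _ ⟨
      sum (λ i → 2 * (ν * out i) + (ν ∸ out i) * (ν ∸ out i))
        ≤⟨ sum-mono (λ i → 2xy+[y∸x]²≤x²+y² (out i) ν) ⟩
      sum (λ i → out i * out i + ν * ν)
        ≡⟨ trans (∑-distrib-+ (λ i → out i * out i) _) (cong (sum (λ i → out i * out i) +_) (sum-const n _)) ⟩
      sum (λ i → out i * out i) + n * (ν * ν) ∎
      where open ≤-Reasoning

    -- The letters stand for the sums of sizes, out-degrees, squared sizes, squared out-degrees and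
    -- cuts, and for the deficit. Now 27ν³ = 3ν(A + 2O) = C + Q + 6νO, where 6νO ≤ 3D + 9ν³ - 3V and
    -- C ≤ 6ν³ + 3V.
    assemble : ∀ A O Q D C V → C + Q ≡ n * A → A + 2 * O ≡ n * n →
              2 * (ν * O) + V ≤ D + n * (ν * ν) → C ≤ 6 * (ν * ν * ν) + 3 * V →
              12 * (ν * ν * ν) ≤ Q + 3 * D
    assemble A O Q D C V C+Q A+2O D≥ C≤ = +-cancelʳ-≤ (C + 9 * (ν * ν * ν)) _ _ (begin
      12 * (ν * ν * ν) + (C + 9 * (ν * ν * ν))
        ≤⟨ +-monoʳ-≤ (12 * (ν * ν * ν)) (+-monoˡ-≤ _ C≤) ⟩
      12 * (ν * ν * ν) + (6 * (ν * ν * ν) + 3 * V + 9 * (ν * ν * ν))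
        ≡⟨ ring₁ ν V ⟩
      3 * ν * (3 * ν * (3 * ν)) + 3 * V
        ≡⟨ cong (λ z → 3 * ν * z + 3 * V) (trans A+2O (cong (λ n → n * n) n≡3ν)) ⟨
      3 * ν * (A + 2 * O) + 3 * V
        ≡⟨ ring₂ ν A O V ⟩
      3 * ν * A + 3 * (2 * (ν * O) + V)
        ≤⟨ +-mono-≤ (≤-reflexive (trans (cong (_* A) (sym n≡3ν)) (sym C+Q))) (*-monoʳ-≤ 3 D≥) ⟩
      C + Q + 3 * (D + n * (ν * ν))
        ≡⟨ cong (λ n → C + Q + 3 * (D + n * (ν * ν))) n≡3ν ⟩
      C + Q + 3 * (D + 3 * ν * (ν * ν))
        ≡⟨ ring₃ C Q D ν ⟩
      Q + 3 * D + (C + 9 * (ν * ν * ν)) ∎)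
      where
      open ≤-Reasoning
      ring₁ : ∀ ν V → 12 * (ν * ν * ν) + (6 * (ν * ν * ν) + 3 * V + 9 * (ν * ν * ν))
                      ≡ 3 * ν * (3 * ν * (3 * ν)) + 3 * V
      ring₁ = solve-∀
      ring₂ : ∀ ν A O V → 3 * ν * (A + 2 * O) + 3 * V ≡ 3 * ν * A + 3 * (2 * (ν * O) + V)
      ring₂ = solve-∀
      ring₃ : ∀ C Q D ν → C + Q + 3 * (D + 3 * ν * (ν * ν)) ≡ Q + 3 * D + (C + 9 * (ν * ν * ν))
      ring₃ = solve-∀

    size²+3out²≥12ν³ : 12 * (ν * ν * ν) ≤ sum (λ i → size i * size i) + 3 * sum (λ i → out i * out i)
    size²+3out²≥12ν³ = assemble (sum size) (sum out) _ _ (sum cut) deficit² cut+size² handshake deficit-bound cut-bound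

T⇒≡true : ∀ {b} → T b → b ≡ true
T⇒≡true {true} _ = refl

≡true⇒T : ∀ {b} → b ≡ true → T b
≡true⇒T refl = _

-- Dense sets of tuples

sumV : ∀ {n} m → (Vec (Fin n) m → ℕ) → ℕ
sumV         zero    f = f []
sumV {n} (suc m) f = ∑[ b < n ] (sumV m λ x → f (b ∷ x))

countV : ∀ {n} m → (Vec (Fin n) m → Bool) → ℕ
countV m P = sumV m λ x → ⟦ P x ⟧

sumV-mono : ∀ {n} m {f g : Vec (Fin n) m → ℕ} → (∀ x → f x ≤ g x) → sumV m f ≤ sumV m g
sumV-mono zero    h = h []
sumV-mono (suc m) h = sum-mono λ b → sumV-mono m λ x → h (b ∷ x)

sumV-cong : ∀ {n} m {f g : Vec (Fin n) m → ℕ} → (∀ x → f x ≡ g x) → sumV m f ≡ sumV m g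
sumV-cong zero    h = h []
sumV-cong (suc m) h = sum-cong-≗ λ b → sumV-cong m λ x → h (b ∷ x)

sumV-+ : ∀ {n} m (f g : Vec (Fin n) m → ℕ) → sumV m (λ x → f x + g x) ≡ sumV m f + sumV m g
sumV-+ zero    f g = refl
sumV-+ {n} (suc m) f g = trans (sum-cong-≗ {n} λ b → sumV-+ m (λ x → f (b ∷ x)) (λ x → g (b ∷ x))) (∑-distrib-+ (λ b → sumV m λ x → f (b ∷ x)) _)

sumV-const : ∀ n m c → sumV {n} m (λ _ → c) ≡ n ^ m * c
sumV-const n zero    c = sym (+-identityʳ c)
sumV-const n (suc m) c =
  trans (sum-cong-≗ {n} λ b → sumV-const n m c) (trans (sum-const n _) (sym (*-assoc n (n ^ m) c)))

sumV-*ˡ : ∀ {n} m c (f : Vec (Fin n) m → ℕ) → sumV m (λ x → c * f x) ≡ c * sumV m f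
sumV-*ˡ zero    c f = refl
sumV-*ˡ {n} (suc m) c f = trans (sum-cong-≗ {n} λ b → sumV-*ˡ m c λ x → f (b ∷ x)) (sum-*ˡ c λ b → sumV m λ x → f (b ∷ x))

sumV-sum : ∀ {n} m {K} (f : Fin K → Vec (Fin n) m → ℕ) →
           sumV m (λ x → ∑[ k < K ] f k x) ≡ ∑[ k < K ] sumV m (f k)
sumV-sum zero    f = refl
sumV-sum {n} (suc m) f = trans (sum-cong-≗ {n} λ b → sumV-sum m λ k x → f k (b ∷ x))
                           (∑-comm λ b k → sumV m λ x → f k (b ∷ x))

countV-positive : ∀ {n} m (P : Vec (Fin n) m → Bool) → 0 < countV m P → ∃ λ x → P x ≡ true
countV-positive zero P h with P [] in e
... | true = [] , e
countV-positive {n} (suc m) P h with any? (λ b → 0 <? countV m (λ x → P (b ∷ x)))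
... | yes (b , hb) = let (x , hx) = countV-positive m _ hb in b ∷ x , hx
... | no none = ⊥-elim (<-irrefl refl (<-≤-trans h (≤-trans (sum-mono {g = λ _ → 0} λ b → ≮⇒≥ λ l → none (b , l))
                  (≤-reflexive (trans (sum-const n 0) (*-zeroʳ n))))))

Dense : ∀ {n} m → ℕ → (Vec (Fin n) m → Bool) → Set
Dense {n} m q P = n ^ m ≤ q * countV m P

dense⇒nonempty : ∀ {n m} .{{_ : NonZero n}} q (P : Vec (Fin n) m → Bool) → Dense m q P → ∃ λ x → P x ≡ true
dense⇒nonempty {n} {m} q P d = countV-positive m P (n≢0⇒n>0 λ e → ≢-nonZero⁻¹ (n ^ m) {{m^n≢0 n m}}
  (n≤0⇒n≡0 (≤-trans d (≤-reflexive (trans (cong (q *_) e) (*-zeroʳ q))))))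

Settles : ∀ {n m} → (Vec (Fin n) m → Bool) → (Vec (Fin n) m → Bool) → Set
Settles P test = ∃ λ v → ∀ x → P x ≡ true → test x ≡ v

-- Of the two halves into which a test splits `P`, keep the larger one; each test costs a factor 2
-- in density.
refine : ∀ {n m} L (tests : Fin L → Vec (Fin n) m → Bool) q P → Dense m q P →
         ∃ λ P′ → Dense m (2 ^ L * q) P′ × (∀ x → P′ x ≡ true → P x ≡ true) × (∀ k → Settles P′ (tests k))
refine {m = m} zero tests q P d = P , subst (λ z → Dense m z P) (sym (+-identityʳ q)) d , (λ x h → h) , λ ()
refine {n} {m} (suc L) tests q P d = choose (≤-total (countV m P₀) (countV m P₁))
  where
  t : Vec (Fin n) m → Bool
  t = tests zero
  P₀ P₁ : Vec (Fin n) m → Bool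
  P₁ x = P x ∧ t x
  P₀ x = P x ∧ not (t x)
  split : countV m P ≡ countV m P₀ + countV m P₁
  split = trans (sumV-cong m λ x → cases (P x) (t x)) (sumV-+ m _ _)
    where
    cases : ∀ a b → ⟦ a ⟧ ≡ ⟦ a ∧ not b ⟧ + ⟦ a ∧ b ⟧
    cases false b     = refl
    cases true  true  = refl
    cases true  false = refl
  descend : ∀ P₂ v → countV m P ≤ 2 * countV m P₂ → (∀ x → P₂ x ≡ true → P x ≡ true) →
            (∀ x → P₂ x ≡ true → t x ≡ v) →
            ∃ λ P′ → Dense m (2 ^ suc L * q) P′ × (∀ x → P′ x ≡ true → P x ≡ true) ×
                     (∀ k → Settles P′ (tests k))
  descend P₂ v c sub tv with refine L (tests ∘ suc) (2 * q) P₂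
    (≤-trans d (≤-trans (*-monoʳ-≤ q c) (≤-reflexive (ring q (countV m P₂)))))
    where
    ring : ∀ q c → q * (2 * c) ≡ 2 * q * c
    ring = solve-∀
  ... | P′ , d′ , sub′ , settled =
    P′ , subst (λ z → Dense m z P′) (ring (2 ^ L) q) d′ , (λ x h → sub x (sub′ x h)) ,
    λ { zero → v , (λ x h → tv x (sub′ x h)) ; (suc k) → settled k }
    where
    ring : ∀ l q → l * (2 * q) ≡ 2 * l * q
    ring = solve-∀
  choose : countV m P₀ ≤ countV m P₁ ⊎ countV m P₁ ≤ countV m P₀ →
           ∃ λ P′ → Dense m (2 ^ suc L * q) P′ × (∀ x → P′ x ≡ true → P x ≡ true) ×
                    (∀ k → Settles P′ (tests k))
  choose (inj₁ l) = descend P₁ true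
    (≤-trans (≤-reflexive split) (≤-trans (+-monoˡ-≤ (countV m P₁) l) (+-monoʳ-≤ (countV m P₁) (≤-reflexive (sym (+-identityʳ (countV m P₁)))))))
    (λ x h → proj₁ (∧-split {P x} h)) (λ x h → proj₂ (∧-split {P x} h))
  choose (inj₂ l) = descend P₀ false
    (≤-trans (≤-reflexive split) (+-monoʳ-≤ (countV m P₀) (≤-trans l (≤-reflexive (sym (+-identityʳ (countV m P₀)))))))
    (λ x h → proj₁ (∧-split {P x} h)) (λ x h → not-true (proj₂ (∧-split {P x} h)))

refine₃ : ∀ {n m} A B C (tests : Fin A → Fin B → Fin C → Vec (Fin n) m → Bool) q P → Dense m q P →
          ∃ λ P′ → Dense m (2 ^ (A * (B * C)) * q) P′ × (∀ x → P′ x ≡ true → P x ≡ true) ×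
                   (∀ a b c → Settles P′ (tests a b c))
refine₃ {n} {m} A B C tests q P d =
  let (P′ , d′ , sub , settled) = refine (A * (B * C)) (test ∘ decode) q P d in
  P′ , d′ , sub , λ a b c → subst (Settles P′ ∘ test) (decode-combine a b c) (settled (combine a (combine b c)))
  where
  test : Fin A × Fin B × Fin C → Vec (Fin n) m → Bool
  test (a , b , c) = tests a b c
  decode : Fin (A * (B * C)) → Fin A × Fin B × Fin C
  decode k = map₂ (remQuot C) (remQuot (B * C) k)
  decode-combine : ∀ a b c → decode (combine a (combine b c)) ≡ (a , b , c)
  decode-combine a b c = trans (cong (map₂ (remQuot C)) (remQuot-combine a (combine b c)))
                               (cong (a ,_) (remQuot-combine b c))

-- From dense sets of tuples to boxes of twins

pick : ∀ {n} K (p : Fin n → Bool) → K ≤ count p →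
       ∃ λ (g : Fin K → Fin n) → (∀ k l → g k ≡ g l → k ≡ l) × (∀ k → p (g k) ≡ true)
pick zero p h = (λ ()) , (λ ()) , λ ()
pick {suc n} (suc K) p h with p zero in p0
... | false = let (g , inj , pg) = pick (suc K) (p ∘ suc) h in
              suc ∘ g , (λ k l e → inj k l (suc-injective e)) , pg
... | true  = let (g , inj , pg) = pick K (p ∘ suc) (s≤s⁻¹ h) in
              (λ { zero → zero ; (suc k) → suc (g k) }) ,
              (λ { zero zero e → refl ; zero (suc l) e → ⊥-elim (0≢1+n e)
                 ; (suc k) zero e → ⊥-elim (0≢1+n (sym e)) ; (suc k) (suc l) e → cong suc (inj k l (suc-injective e)) }) ,
              (λ { zero → p0 ; (suc k) → pg k })

-- K rich vertices b (those with |P_b| ≥ n^m/2q) are listed; many tuples x are hit by at least M of them,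
-- and by pigeonhole many are hit by the same M.
module Star {n : ℕ} .{{_ : NonZero n}} (m M q K : ℕ) .{{_ : NonZero q}} (K≡ : K ≡ 2 * q * (2 * suc M))
  (N≤n : 2 * q * K ≤ n) (P : Vec (Fin n) (suc m) → Bool) (dense : Dense (suc m) q P) where

  open ≤-Reasoning
  deg : Fin n → ℕ
  deg b = countV m λ x → P (b ∷ x)
  rich : Fin n → Bool
  rich b = n ^ m ≤ᵇ 2 * q * deg b
  instance
    nm≢0 : NonZero (n ^ m)
    nm≢0 = m^n≢0 n m
    2q≢0 : NonZero (2 * q)
    2q≢0 = m*n≢0 2 q

  deg≤ : ∀ b → 2 * q * deg b ≤ ⟦ rich b ⟧ * (2 * q * n ^ m) + n ^ m
  deg≤ b with n ^ m ≤ᵇ 2 * q * deg b in e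
  ... | true  = begin
    2 * q * deg b                  ≤⟨ *-monoʳ-≤ (2 * q) (sumV-mono m λ x → ⟦⟧≤1 (P (b ∷ x))) ⟩
    2 * q * sumV {n} m (λ _ → 1)   ≡⟨ cong (2 * q *_) (trans (sumV-const n m 1) (*-identityʳ _)) ⟩
    2 * q * n ^ m                  ≡⟨ +-identityʳ _ ⟨
    1 * (2 * q * n ^ m)            ≤⟨ m≤m+n _ _ ⟩
    1 * (2 * q * n ^ m) + n ^ m    ∎
  ... | false = ≰⇒≥ λ l → clash (T⇒≡true (≤⇒≤ᵇ l)) e

  -- Vertices that are not rich account for at most half of the n^(m+1)/q tuples required. A rich
  -- vertex has degree at most n^m, so the other half takes at least n/2q ≥ K of them.
  many-rich : K ≤ count rich
  many-rich = *-cancelˡ-≤ (2 * q) (≤-trans N≤n (*-cancelʳ-≤ n (2 * q * count rich) (n ^ m) (+-cancelʳ-≤ (n * n ^ m) (n * n ^ m) (2 * q * count rich * n ^ m) (begin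
    n * n ^ m + n * n ^ m                             ≡⟨ cong (n * n ^ m +_) (+-identityʳ _) ⟨
    2 * (n * n ^ m)                                   ≤⟨ *-monoʳ-≤ 2 dense ⟩
    2 * (q * sum deg)                                 ≡⟨ *-assoc 2 q (sum deg) ⟨
    2 * q * sum deg                                   ≡⟨ sum-*ˡ (2 * q) deg ⟨
    sum (λ b → 2 * q * deg b)                         ≤⟨ sum-mono deg≤ ⟩
    sum (λ b → ⟦ rich b ⟧ * (2 * q * n ^ m) + n ^ m)  ≡⟨ ∑-distrib-+ (λ b → ⟦ rich b ⟧ * (2 * q * n ^ m)) (λ _ → n ^ m) ⟩
    sum (λ b → ⟦ rich b ⟧ * (2 * q * n ^ m)) + sum {n} (λ _ → n ^ m)
                                                      ≡⟨ cong₂ _+_ (sum-*ʳ (λ b → ⟦ rich b ⟧) (2 * q * n ^ m)) (sum-const n (n ^ m)) ⟩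
    count rich * (2 * q * n ^ m) + n * n ^ m          ≡⟨ cong (_+ n * n ^ m) (ring (count rich) (2 * q) (n ^ m)) ⟩
    2 * q * count rich * n ^ m + n * n ^ m            ∎))))
    where
    ring : ∀ c q x → c * (q * x) ≡ q * c * x
    ring = solve-∀

  richK : ∃ λ (g : Fin K → Fin n) → (∀ k l → g k ≡ g l → k ≡ l) × (∀ k → rich (g k) ≡ true)
  richK = pick K rich many-rich
  g : Fin K → Fin n
  g = proj₁ richK
  mult : Vec (Fin n) m → ℕ
  mult x = count (λ k → P (g k ∷ x))
  Q : Vec (Fin n) m → Bool
  Q x = M <ᵇ mult x

  mult-sum : 2 * suc M * n ^ m ≤ sumV m mult
  mult-sum = *-cancelˡ-≤ (2 * q) (begin
    2 * q * (2 * suc M * n ^ m)               ≡⟨ trans (sym (*-assoc (2 * q) (2 * suc M) (n ^ m))) (cong (_* n ^ m) (sym K≡)) ⟩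
    K * n ^ m                                 ≡⟨ sum-const K (n ^ m) ⟨
    sum {K} (λ _ → n ^ m)                     ≤⟨ sum-mono (λ k → ≤ᵇ⇒≤ (n ^ m) (2 * q * deg (g k)) (≡true⇒T (proj₂ (proj₂ richK) k))) ⟩
    sum (λ k → 2 * q * deg (g k))             ≡⟨ sum-*ˡ (2 * q) (deg ∘ g) ⟩
    2 * q * sum (deg ∘ g)                     ≡⟨ cong (2 * q *_) (sumV-sum m λ k x → ⟦ P (g k ∷ x) ⟧) ⟨
    2 * q * sumV m mult                       ∎)

  mult≤ : ∀ x → mult x ≤ K * ⟦ Q x ⟧ + suc M
  mult≤ x with M <ᵇ mult x in e
  ... | true  = begin
    mult x              ≤⟨ sum-mono (λ k → ⟦⟧≤1 (P (g k ∷ x))) ⟩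
    sum {K} (λ _ → 1)   ≡⟨ sum-const K 1 ⟩
    K * 1               ≤⟨ m≤m+n _ _ ⟩
    K * 1 + suc M       ∎
  ... | false = ≤-trans (≮⇒≥ λ l → clash (≤⇒<ᵇ l) e) (≤-trans (n≤1+n M) (m≤n+m (suc M) (K * 0)))

  -- On average `mult` is at least 2(M + 1). It is at most M + 1 outside `Q` and at most K inside,
  -- so K times the size of `Q` is at least (M + 1) n^m.
  Q-dense : Dense m K Q
  Q-dense = ≤-trans (m≤n*m (n ^ m) (suc M)) (+-cancelʳ-≤ (suc M * n ^ m) _ _ (begin
    suc M * n ^ m + suc M * n ^ m             ≡⟨ ring (suc M) (n ^ m) ⟩
    2 * suc M * n ^ m                         ≤⟨ mult-sum ⟩
    sumV m mult                               ≤⟨ sumV-mono m mult≤ ⟩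
    sumV m (λ x → K * ⟦ Q x ⟧ + suc M)        ≡⟨ trans (sumV-+ m (λ x → K * ⟦ Q x ⟧) _) (cong₂ _+_ (sumV-*ˡ m K (λ x → ⟦ Q x ⟧))
                                                   (trans (sumV-const n m (suc M)) (*-comm (n ^ m) (suc M)))) ⟩
    K * countV m Q + suc M * n ^ m            ∎))
    where
    ring : ∀ a b → a * b + a * b ≡ 2 * a * b
    ring = solve-∀

  refined : ∃ λ Q′ → Dense m (2 ^ K * K) Q′ × (∀ x → Q′ x ≡ true → Q x ≡ true) × (∀ k → Settles Q′ (λ x → P (g k ∷ x)))
  refined = refine K (λ k x → P (g k ∷ x)) K Q Q-dense
  Q′ : Vec (Fin n) m → Bool
  Q′ = proj₁ refined
  settled : ∀ k → Settles Q′ (λ x → P (g k ∷ x))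
  settled = proj₂ (proj₂ (proj₂ refined))
  Q′-dense : Dense m (2 ^ K * K) Q′
  Q′-dense = proj₁ (proj₂ refined)

  -- The answers are constant on `Q′`, so this one tuple shows that at least M of them are `true`.
  witness : ∃ λ x → Q′ x ≡ true
  witness = dense⇒nonempty (2 ^ K * K) Q′ Q′-dense

  chosen : ∃ λ (h : Fin M → Fin K) → (∀ k l → h k ≡ h l → k ≡ l) × (∀ k → proj₁ (settled (h k)) ≡ true)
  chosen = pick M (proj₁ ∘ settled) (begin
    M                           ≤⟨ <⇒≤ (<ᵇ-true (proj₁ (proj₂ (proj₂ refined)) (proj₁ witness) (proj₂ witness))) ⟩
    mult (proj₁ witness)        ≡⟨ sum-cong-≗ (λ k → cong ⟦_⟧ (proj₂ (settled k) (proj₁ witness) (proj₂ witness))) ⟩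
    count (proj₁ ∘ settled)     ∎)

  B : Fin M → Fin n
  B = g ∘ proj₁ chosen
  B-inj : ∀ k l → B k ≡ B l → k ≡ l
  B-inj k l e = proj₁ (proj₂ chosen) k l (proj₁ (proj₂ richK) _ _ e)
  B-star : ∀ k x → Q′ x ≡ true → P (B k ∷ x) ≡ true
  B-star k x h = trans (proj₂ (settled (proj₁ chosen k)) x h) (proj₂ (proj₂ chosen) k)

-- A complete m-partite system inside `P` with two vertices in each class, the twins. That twins of
-- different classes differ is derived later from the constancy of the coincidence tests.
record Box {n m} (E : Fin n → Fin n → Fin n → Bool) (P : Vec (Fin n) m → Bool) : Set where
  field
    β           : Fin m → Bool → Fin n
    distinct    : ∀ i → β i true ≢ β i false
    inside      : ∀ (s : Fin m → Bool) → P (tabulate λ i → β i (s i)) ≡ true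
    homogeneous : ∀ i j → i ≢ j →
                  E (β i true) (β i false) (β j true) ≡ E (β i true) (β i false) (β j false)

bit : Bool → Fin 2
bit false = zero
bit true  = suc zero

bit-injective : ∀ {a b} → bit a ≡ bit b → a ≡ b
bit-injective {false} {false} e = refl
bit-injective {true}  {true}  e = refl

bits-pigeonhole : ∀ {m M} → 2 ^ m < M → (c : Fin M → Fin m → Bool) →
                  ∃ λ s → ∃ λ t → s ≢ t × (∀ j → c s j ≡ c t j)
bits-pigeonhole l c with pigeonhole l (λ s → funToFin (bit ∘ c s))
... | s , t , s<t , e = s , t , (λ { refl → <-irrefl refl s<t }) , λ j → bit-injective (begin
  bit (c s j)                              ≡⟨ finToFun-funToFin (bit ∘ c s) j ⟨
  finToFun (funToFin (bit ∘ c s)) j        ≡⟨ cong (λ k → finToFun k j) e ⟩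
  finToFun (funToFin (bit ∘ c t)) j        ≡⟨ finToFun-funToFin (bit ∘ c t) j ⟩
  bit (c t j)                              ∎)
  where open ≡-Reasoning

-- Two of the M vertices `B` become the new twins. How they form edges with old vertices is settled
-- on `P′` in advance. Each old pair must treat them alike: there are 2^m possible patterns over the
-- old pairs and more than 2^m candidates, so two candidates agree.
box-extend : ∀ {n m M} {E : Fin n → Fin n → Fin n → Bool} {P : Vec (Fin n) (suc m) → Bool} → 2 ^ m < M →
             (B : Fin M → Fin n) → (∀ k l → B k ≡ B l → k ≡ l) →
             (P′ : Vec (Fin n) m → Bool) → (∀ k x → P′ x ≡ true → P (B k ∷ x) ≡ true) →
             (∀ k l j → Settles P′ λ x → E (B k) (B l) (lookup x j)) →
             Box E P′ → Box E P
box-extend {n} {m} {M} {E} bits B B-inj P′ B-star settled small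
  with bits-pigeonhole bits (λ s j → E (Box.β small j true) (Box.β small j false) (B s))
... | s , t , s≢t , agree = record
  { β           = β′
  ; distinct    = λ { zero e → s≢t (B-inj s t e) ; (suc i) → distinct i }
  ; inside      = λ σ → B-star (pos (σ zero)) _ (inside (σ ∘ suc))
  ; homogeneous = λ { zero    zero    h → ⊥-elim (h refl)
                    ; zero    (suc j) h → trans (same j true) (sym (same j false))
                    ; (suc i) zero    h → agree i
                    ; (suc i) (suc j) h → homogeneous i j (h ∘ cong suc) }
  }
  where
  open Box small
  pos : Bool → Fin M
  pos true  = s
  pos false = t
  β′ : Fin (suc m) → Bool → Fin n
  β′ zero    v = B (pos v)
  β′ (suc i) v = β i v
  same : ∀ j v → E (B s) (B t) (β j v) ≡ proj₁ (settled s t j)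
  same j v = trans (cong (E (B s) (B t)) (sym (lookup∘tabulate (λ i → β i v) j)))
                   (proj₂ (settled s t j) _ (inside λ _ → v))

box-step : ∀ {n} .{{_ : NonZero n}} m M q K .{{_ : NonZero q}} → 2 ^ m < M → K ≡ 2 * q * (2 * suc M) →
           2 * q * K ≤ n → (E : Fin n → Fin n → Fin n → Bool) (P : Vec (Fin n) (suc m) → Bool) →
           Dense (suc m) q P →
           (∀ P′ → Dense m (2 ^ (M * (M * m)) * (2 ^ K * K)) P′ → Box E P′) → Box E P
box-step {n} m M q K bits K≡ N≤n E P dense ih = finish
  (refine₃ M M m (λ s t j x → E (B s) (B t) (lookup x j)) (2 ^ K * K) Q′ Q′-dense)
  where
  open Star m M q K K≡ N≤n P dense
  finish : (∃ λ P′ → Dense m (2 ^ (M * (M * m)) * (2 ^ K * K)) P′ × (∀ x → P′ x ≡ true → Q′ x ≡ true) ×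
                     (∀ k l j → Settles P′ λ x → E (B k) (B l) (lookup x j))) → Box E P
  finish (P′ , d′ , sub , settled) =
    box-extend bits B B-inj P′ (λ k x h → B-star k x (sub x h)) settled (ih P′ d′)

-- Induction on m as in the extension of the Kővári-Sós-Turán theorem to m-partite systems: fix many
-- candidates for the first class, find a box in the tuples common to them, and only then choose two
-- of them.
box : ∀ m q .{{_ : NonZero q}} → ∃ λ N → ∀ n .{{_ : NonZero n}} → N ≤ n →
      (E : Fin n → Fin n → Fin n → Bool) (P : Vec (Fin n) m → Bool) → Dense m q P → Box E P
box zero    q = 0 , λ n _ E P d → record
  { β = λ () ; distinct = λ () ; homogeneous = λ ()
  ; inside = λ _ → case dense⇒nonempty q P d of λ { ([] , h) → h } }
box (suc m) q = 2 * q * K ⊔ proj₁ ih , λ n N≤n E P d →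
  box-step m (suc (2 ^ m)) q K ≤-refl refl (m⊔n≤o⇒m≤o _ _ N≤n) E P d
    (proj₂ ih n (m⊔n≤o⇒n≤o (2 * q * K) _ N≤n) E)
  where
  M K q′ : ℕ
  M  = suc (2 ^ m)
  K  = 2 * q * (2 * suc M)
  -- The tuples common to the M candidates have density at least 1/(2^K K); settling the M · M · m
  -- tests on them costs a factor 2 each.
  q′ = 2 ^ (M * (M * m)) * (2 ^ K * K)
  instance
    K≢0 : NonZero K
    K≢0 = m*n≢0 (2 * q) (2 * suc M) {{m*n≢0 2 q}}
    q′≢0 : NonZero q′
    q′≢0 = m*n≢0 (2 ^ (M * (M * m))) (2 ^ K * K) {{m^n≢0 2 (M * (M * m))}} {{m*n≢0 (2 ^ K) K {{m^n≢0 2 K}}}}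
  ih : ∃ λ N → ∀ n .{{_ : NonZero n}} → N ≤ n →
       (E : Fin n → Fin n → Fin n → Bool) (P : Vec (Fin n) m → Bool) → Dense m q′ P → Box E P
  ih = box m q′

-- From arrows between twins to edges

one-of-three : ∀ {x y z} → ⟦ x ⟧ + (⟦ y ⟧ + ⟦ z ⟧) ≡ 1 →
  (x ≡ true × y ≡ false × z ≡ false) ⊎ (x ≡ false × y ≡ true × z ≡ false) ⊎ (x ≡ false × y ≡ false × z ≡ true)
one-of-three {true}  {false} {false} e = inj₁ (refl , refl , refl)
one-of-three {false} {true}  {false} e = inj₂ (inj₁ (refl , refl , refl))
one-of-three {false} {false} {true}  e = inj₂ (inj₂ (refl , refl , refl))

-- The three sums describe the pairs ij, ik, jk of vertices: same part, arrow forward, arrow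
-- backward. The conjunctions say that all three lie in one part, or that i, j or k dominates the
-- other two; no two of these can hold together.
exclusive : ∀ {e₁ t₁ u₁ e₂ t₂ u₂ e₃ t₃ u₃} →
  ⟦ e₁ ⟧ + (⟦ t₁ ⟧ + ⟦ u₁ ⟧) ≡ 1 → ⟦ e₂ ⟧ + (⟦ t₂ ⟧ + ⟦ u₂ ⟧) ≡ 1 → ⟦ e₃ ⟧ + (⟦ t₃ ⟧ + ⟦ u₃ ⟧) ≡ 1 →
  ⟦ e₁ ∧ e₂ ⟧ + (⟦ t₁ ∧ t₂ ⟧ + (⟦ u₁ ∧ t₃ ⟧ + ⟦ u₂ ∧ u₃ ⟧)) ≤ 1
exclusive {e₁} {t₁} {u₁} {e₂} {t₂} {u₂} {e₃} {t₃} {u₃} h₁ h₂ h₃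
  with one-of-three {e₁} {t₁} {u₁} h₁ | one-of-three {e₂} {t₂} {u₂} h₂ | one-of-three {e₃} {t₃} {u₃} h₃
... | inj₁ (refl , refl , refl)        | inj₁ (refl , refl , refl)        | _ = ≤-refl
... | inj₁ (refl , refl , refl)        | inj₂ (inj₁ (refl , refl , refl)) | _ = z≤n
... | inj₁ (refl , refl , refl)        | inj₂ (inj₂ (refl , refl , refl)) | _ = ⟦⟧≤1 u₃
... | inj₂ (inj₁ (refl , refl , refl)) | inj₁ (refl , refl , refl)        | _ = z≤n
... | inj₂ (inj₁ (refl , refl , refl)) | inj₂ (inj₁ (refl , refl , refl)) | _ = ≤-refl
... | inj₂ (inj₁ (refl , refl , refl)) | inj₂ (inj₂ (refl , refl , refl)) | _ = ⟦⟧≤1 u₃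
... | inj₂ (inj₂ (refl , refl , refl)) | inj₁ (refl , refl , refl)        | _ = subst (_≤ 1) (sym (+-identityʳ _)) (⟦⟧≤1 t₃)
... | inj₂ (inj₂ (refl , refl , refl)) | inj₂ (inj₁ (refl , refl , refl)) | inj₁ (refl , refl , refl) = z≤n
... | inj₂ (inj₂ (refl , refl , refl)) | inj₂ (inj₁ (refl , refl , refl)) | inj₂ (inj₁ (refl , refl , refl)) = ≤-refl
... | inj₂ (inj₂ (refl , refl , refl)) | inj₂ (inj₁ (refl , refl , refl)) | inj₂ (inj₂ (refl , refl , refl)) = z≤n
... | inj₂ (inj₂ (refl , refl , refl)) | inj₂ (inj₂ (refl , refl , refl)) | inj₁ (refl , refl , refl) = z≤n
... | inj₂ (inj₂ (refl , refl , refl)) | inj₂ (inj₂ (refl , refl , refl)) | inj₂ (inj₁ (refl , refl , refl)) = ≤-refl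
... | inj₂ (inj₂ (refl , refl , refl)) | inj₂ (inj₂ (refl , refl , refl)) | inj₂ (inj₂ (refl , refl , refl)) = ≤-refl

same : ∀ {n} → Fin n → Fin n → Bool
same i j = ⌊ i ≟ j ⌋

same-refl : ∀ {n} (i : Fin n) → same i i ≡ true
same-refl i with i ≟ i
... | yes _ = refl
... | no h  = ⊥-elim (h refl)

same-≢ : ∀ {n} {i j : Fin n} → i ≢ j → same i j ≡ false
same-≢ {i = i} {j} h with i ≟ j
... | yes e = ⊥-elim (h e)
... | no _  = refl

same-sym : ∀ {n} (i j : Fin n) → same i j ≡ same j i
same-sym i j with i ≟ j
... | yes refl = sym (same-refl i)
... | no h     = sym (same-≢ (h ∘ sym))

count-same : ∀ {n} (i : Fin n) → count (same i) ≡ 1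
count-same {suc n} zero    = cong suc (count-none (λ (j : Fin n) → same zero (suc j)) λ j → refl)
count-same {suc n} (suc i) = trans (sum-cong-≗ λ j → cong ⟦_⟧ (shift i j)) (count-same i)
  where
  shift : ∀ (i j : Fin n) → same (suc i) (suc j) ≡ same i j
  shift i j with i ≟ j
  ... | yes _ = refl
  ... | no _  = refl

sum₃ : ∀ {n} → (Fin n → Fin n → Fin n → ℕ) → ℕ
sum₃ {n} f = ∑[ i < n ] ∑[ j < n ] ∑[ k < n ] f i j k

sum₃-+ : ∀ {n} (f g : Fin n → Fin n → Fin n → ℕ) →
         sum₃ (λ i j k → f i j k + g i j k) ≡ sum₃ f + sum₃ g
sum₃-+ {n} f g = trans
  (sum-cong-≗ {n} λ i → trans (sum-cong-≗ {n} λ j → ∑-distrib-+ (f i j) (g i j))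
                              (∑-distrib-+ (λ j → sum (f i j)) (λ j → sum (g i j))))
  (∑-distrib-+ (λ i → sum λ j → sum (f i j)) (λ i → sum λ j → sum (g i j)))

sum-product : ∀ {n} (p q : Fin n → Bool) → ∑[ j < n ] ∑[ k < n ] ⟦ p j ∧ q k ⟧ ≡ count p * count q
sum-product {n} p q = trans
  (sum-cong-≗ {n} λ j → trans (sum-cong-≗ {n} λ k → ⟦∧⟧ (p j) (q k)) (sum-*ˡ ⟦ p j ⟧ λ k → ⟦ q k ⟧))
  (sum-*ʳ (λ j → ⟦ p j ⟧) (count q))

-- σ i j records whether the i-th twins span an edge with the j-th vertices, and τ the transversal edges.
module Blowup {m : ℕ} (σ : Fin m → Fin m → Bool) (τ : Fin m → Fin m → Fin m → Bool)
  (τ-swap₁ : ∀ i j k → τ i j k ≡ τ j i k) (τ-swap₂ : ∀ i j k → τ i j k ≡ τ i k j)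
  (total   : ∀ i j → i ≢ j → σ i j ≡ false → σ j i ≡ true)
  (joint   : ∀ i j k → i ≢ j → i ≢ k → j ≢ k → σ i j ≡ true → σ j i ≡ true →
             σ i k ≡ true → σ j k ≡ true → τ i j k ≡ true)
  (spread  : ∀ i j k → i ≢ j → i ≢ k → j ≢ k → σ i j ≡ true → σ j i ≡ true →
             σ j k ≡ true → τ i j k ≡ true → σ i k ≡ true)
  (source  : ∀ i j k → i ≢ j → i ≢ k → j ≢ k → σ k i ≡ false → σ k j ≡ false → τ i j k ≡ true)
  (turan   : ∀ i j k l → i ≢ j → i ≢ k → i ≢ l → j ≢ k → j ≢ l → k ≢ l →
             τ i j k ≡ false → τ i j l ≡ false → τ i k l ≡ false → τ j k l ≡ false → ⊥)
  where

  -- `σ i j` is the arrow from j to i, whence the reversed indices in `to`. Diagonal values of `σ`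
  -- are arbitrary here and are overridden by `same`.
  eq to : Fin m → Fin m → Bool
  eq i j = same i j ∨ (σ i j ∧ σ j i)
  to i j = not (same i j) ∧ (σ j i ∧ not (σ i j))

  eq-refl : ∀ i → eq i i ≡ true
  eq-refl i rewrite same-refl i = refl

  eq-sym′ : ∀ i j → eq i j ≡ eq j i
  eq-sym′ i j = cong₂ _∨_ (same-sym i j) (∧-comm (σ i j) (σ j i))

  eq-split : ∀ i j → i ≢ j → eq i j ≡ true → σ i j ≡ true × σ j i ≡ true
  eq-split i j h e rewrite same-≢ h = ∧-split e

  to-split : ∀ i j → to i j ≡ true → i ≢ j × σ j i ≡ true × σ i j ≡ false
  to-split i j h with i ≟ j
  ... | no ne = let (a , b) = ∧-split {σ j i} h in ne , a , not-true b

  -- If `σ i k` failed, `total` would give `σ k i` and `joint` the edge ijk; then `spread` would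
  -- carry `σ j k` over to i after all.
  σ-trans : ∀ i j k → i ≢ j → i ≢ k → j ≢ k → σ i j ≡ true → σ j i ≡ true →
            σ j k ≡ true → σ k j ≡ true → σ i k ≡ true
  σ-trans i j k ij ik jk a b c d with σ i k in e
  ... | true  = refl
  ... | false = trans (sym e) (spread i j k ij ik jk a b c
      (trans (trans (τ-swap₁ i j k) (trans (τ-swap₂ j i k) (τ-swap₁ j k i)))
        (joint k j i (jk ∘ sym) (ik ∘ sym) (ij ∘ sym) d c (total i k ik e) b)))

  eq-trans : ∀ i j k → eq i j ≡ true → eq j k ≡ true → eq i k ≡ true
  eq-trans i j k a b with i ≟ k
  ... | yes refl = refl
  ... | no ik = by-cases (i ≟ j) (j ≟ k)
    where
    by-cases : Dec (i ≡ j) → Dec (j ≡ k) → σ i k ∧ σ k i ≡ true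
    by-cases (yes refl) _ = let (x , y) = eq-split i k ik b in ∧-true x y
    by-cases (no ij) (yes refl) = let (x , y) = eq-split i k ik a in ∧-true x y
    by-cases (no ij) (no jk) =
      let (p , q) = eq-split i j ij a ; (r , s) = eq-split j k jk b in
      ∧-true (σ-trans i j k ij ik jk p q r s)
             (σ-trans k j i (jk ∘ sym) (ik ∘ sym) (ij ∘ sym) s r q p)

  oriented : ∀ i j → ⟦ eq i j ⟧ + (⟦ to i j ⟧ + ⟦ to j i ⟧) ≡ 1
  oriented i j with i ≟ j
  ... | yes refl rewrite same-refl i = refl
  ... | no h rewrite same-≢ (h ∘ sym) with σ i j in a | σ j i in b
  ...   | true  | true  = refl
  ...   | true  | false = refl
  ...   | false | true  = refl
  ...   | false | false = clash (total i j h a) b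

  -- Each triple of the cycle contains two vertices of one part, and exactly one of these receives
  -- an arrow from the third vertex. By `spread` the triple is then not an edge, so all four triples
  -- are missing, against `turan`.
  no-C₄ : ∀ a a′ b b′ → eq a a′ ≡ true → eq b b′ ≡ true →
          to a b ≡ true → to b a′ ≡ true → to a′ b′ ≡ true → to b′ a ≡ true → ⊥
  no-C₄ a a′ b b′ aa bb ab ba′ a′b′ b′a
    with to-split a b ab | to-split b a′ ba′ | to-split a′ b′ a′b′ | to-split b′ a b′a
  ... | a≢b , σba , ¬σab | b≢a′ , σa′b , ¬σba′ | a′≢b′ , σb′a′ , ¬σa′b′ | b′≢a , σab′ , ¬σb′a =
    turan a a′ b b′ a≢a′ a≢b (b′≢a ∘ sym) (b≢a′ ∘ sym) a′≢b′ b≢b′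
      (≡false λ t → clash (spread a a′ b a≢a′ a≢b (b≢a′ ∘ sym) σaa′ σa′a σa′b t) ¬σab)
      (≡false λ t → clash (spread a′ a b′ (a≢a′ ∘ sym) a′≢b′ (b′≢a ∘ sym) σa′a σaa′ σab′
                             (trans (τ-swap₁ a′ a b′) t)) ¬σa′b′)
      (≡false λ t → clash (spread b′ b a (b≢b′ ∘ sym) b′≢a (a≢b ∘ sym) σb′b σbb′ σba
                             (trans (trans (τ-swap₁ b′ b a) (trans (τ-swap₂ b b′ a) (τ-swap₁ b a b′))) t)) ¬σb′a)
      (≡false λ t → clash (spread b b′ a′ b≢b′ b≢a′ (a′≢b′ ∘ sym) σbb′ σb′b σb′a′
                             (trans (trans (τ-swap₂ b b′ a′) (τ-swap₁ b a′ b′)) t)) ¬σba′)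
    where
    a≢a′ : a ≢ a′
    a≢a′ refl = clash σba ¬σba′
    b≢b′ : b ≢ b′
    b≢b′ refl = clash σab′ ¬σab
    σaa′ : σ a a′ ≡ true
    σaa′ = proj₁ (eq-split a a′ a≢a′ aa)
    σa′a : σ a′ a ≡ true
    σa′a = proj₂ (eq-split a a′ a≢a′ aa)
    σbb′ : σ b b′ ≡ true
    σbb′ = proj₁ (eq-split b b′ b≢b′ bb)
    σb′b : σ b′ b ≡ true
    σb′b = proj₂ (eq-split b b′ b≢b′ bb)

  open Multipartite eq to eq-refl (λ i j h → trans (eq-sym′ j i) h) eq-trans oriented no-C₄

  triangle star : Fin m → Fin m → Fin m → Bool
  triangle i j k = eq i j ∧ eq i k
  star i j k     = to i j ∧ to i k

  pattern-count : Fin m → Fin m → Fin m → ℕ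
  pattern-count i j k = ⟦ triangle i j k ⟧ + (⟦ star i j k ⟧ + (⟦ star j i k ⟧ + ⟦ star k i j ⟧))

  at-most-one : ∀ i j k → pattern-count i j k ≤ 1
  at-most-one i j k = exclusive {eq i j} {to i j} {to j i} {eq i k} {to i k} {to k i} {eq j k} {to j k} {to k j}
                        (oriented i j) (oriented i k) (oriented j k)

  triangle-edge : ∀ i j k → i ≢ j → i ≢ k → j ≢ k → triangle i j k ≡ true → τ i j k ≡ true
  triangle-edge i j k ij ik jk h =
    let (p , q) = ∧-split {eq i j} h ; (a , b) = eq-split i j ij p ; (c , d) = eq-split i k ik q in
    joint i j k ij ik jk a b c (σ-trans j i k (ij ∘ sym) jk ik b a c d)

  star-edge : ∀ i j k → i ≢ j → i ≢ k → j ≢ k → star i j k ≡ true → τ i j k ≡ true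
  star-edge i j k ij ik jk h =
    let (p , q) = ∧-split {to i j} h ; (_ , _ , a) = to-split i j p ; (_ , _ , b) = to-split i k q in
    trans (trans (τ-swap₁ i j k) (τ-swap₂ j i k)) (source j k i jk (ij ∘ sym) (ik ∘ sym) a b)

  -- On distinct vertices each pattern forces an edge. On other triples a coincidence on the right
  -- pays for the only pattern that can occur.
  pattern≤edge : ∀ i j k → pattern-count i j k ≤ ⟦ τ i j k ⟧ + (⟦ same i j ⟧ + (⟦ same i k ⟧ + ⟦ same j k ⟧))
  pattern≤edge i j k = by-cases (i ≟ j) (i ≟ k) (j ≟ k)
    where
    degenerate : ∀ {x} → 1 ≤ x → pattern-count i j k ≤ ⟦ τ i j k ⟧ + x
    degenerate 1≤x = ≤-trans (at-most-one i j k) (≤-trans 1≤x (m≤n+m _ ⟦ τ i j k ⟧))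
    one : ∀ {b} → b ≡ true → 1 ≤ ⟦ b ⟧
    one refl = ≤-refl
    edge-case : i ≢ j → i ≢ k → j ≢ k → pattern-count i j k ≤ ⟦ τ i j k ⟧
    edge-case ij ik jk with τ i j k in e
    ... | true  = at-most-one i j k
    ... | false
      rewrite ≡false (λ h → clash (triangle-edge i j k ij ik jk h) e)
            | ≡false (λ h → clash (star-edge i j k ij ik jk h) e)
            | ≡false (λ h → clash (trans (τ-swap₁ i j k) (star-edge j i k (ij ∘ sym) jk ik h)) e)
            | ≡false (λ h → clash (trans (trans (τ-swap₂ i j k) (τ-swap₁ i k j))
                                         (star-edge k i j (ik ∘ sym) (jk ∘ sym) ij h)) e) = z≤n
    by-cases : Dec (i ≡ j) → Dec (i ≡ k) → Dec (j ≡ k) →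
               pattern-count i j k ≤ ⟦ τ i j k ⟧ + (⟦ same i j ⟧ + (⟦ same i k ⟧ + ⟦ same j k ⟧))
    by-cases (yes refl) _ _ = degenerate (≤-trans (one (same-refl i)) (m≤m+n _ _))
    by-cases (no _) (yes refl) _ =
      degenerate (≤-trans (one (same-refl i)) (≤-trans (m≤m+n _ _) (m≤n+m _ ⟦ same i j ⟧)))
    by-cases (no _) (no _) (yes refl) =
      degenerate (≤-trans (one (same-refl j)) (≤-trans (m≤n+m _ ⟦ same i k ⟧) (m≤n+m _ ⟦ same i j ⟧)))
    by-cases (no ij) (no ik) (no jk) = ≤-trans (edge-case ij ik jk) (m≤m+n _ _)

  t₀ t₁ t₂ t₃ : Fin m → Fin m → Fin m → ℕ
  t₀ i j k = ⟦ triangle i j k ⟧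
  t₁ i j k = ⟦ star i j k ⟧
  t₂ i j k = ⟦ star j i k ⟧
  t₃ i j k = ⟦ star k i j ⟧

  -- For fixed i the two other vertices range independently over the part of i, or over the
  -- out-neighbours of i. The three kinds of star differ by the order of summation only.
  pattern-sum : sum₃ pattern-count ≡ sum (λ i → size i * size i) + 3 * sum (λ i → out i * out i)
  pattern-sum = begin
    sum₃ pattern-count
      ≡⟨ sum₃-+ t₀ (λ i j k → t₁ i j k + (t₂ i j k + t₃ i j k)) ⟩
    sum₃ t₀ + sum₃ (λ i j k → t₁ i j k + (t₂ i j k + t₃ i j k))
      ≡⟨ cong₂ _+_ (sum-cong-≗ {m} λ i → sum-product (eq i) (eq i))
           (trans (sum₃-+ t₁ (λ i j k → t₂ i j k + t₃ i j k)) (cong (sum₃ t₁ +_) (sum₃-+ t₂ t₃))) ⟩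
    sizes² + (sum₃ t₁ + (sum₃ t₂ + sum₃ t₃))
      ≡⟨ cong₂ (λ x y → sizes² + (sum₃ t₁ + (x + y)))
           (∑-comm {m} {m} λ i j → sum (t₂ i j))
           (trans (sum-cong-≗ {m} λ i → ∑-comm {m} {m} (t₃ i)) (∑-comm {m} {m} λ i k → sum λ j → t₃ i j k)) ⟩
    sizes² + (sum₃ t₁ + (sum₃ t₁ + sum₃ t₁))
      ≡⟨ cong (sizes² +_) (trans (cong (λ z → sum₃ t₁ + (sum₃ t₁ + z)) (sym (+-identityʳ (sum₃ t₁))))
           (cong (3 *_) (sum-cong-≗ {m} λ i → sum-product (to i) (to i)))) ⟩
    sizes² + 3 * sum (λ i → out i * out i) ∎
    where
    open ≡-Reasoning
    sizes² : ℕ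
    sizes² = sum λ i → size i * size i

  d₁ d₂ d₃ : Fin m → Fin m → Fin m → ℕ
  d₁ i j k = ⟦ same i j ⟧
  d₂ i j k = ⟦ same i k ⟧
  d₃ i j k = ⟦ same j k ⟧

  diagonals : sum₃ (λ i j k → d₁ i j k + (d₂ i j k + d₃ i j k)) ≡ 3 * (m * m)
  diagonals = begin
    sum₃ (λ i j k → d₁ i j k + (d₂ i j k + d₃ i j k))
      ≡⟨ trans (sum₃-+ d₁ (λ i j k → d₂ i j k + d₃ i j k)) (cong (sum₃ d₁ +_) (sum₃-+ d₂ d₃)) ⟩
    sum₃ d₁ + (sum₃ d₂ + sum₃ d₃)
      ≡⟨ cong₂ _+_ (sum-cong-≗ {m} λ i → trans (sum-cong-≗ {m} λ j → trans (sum-const m ⟦ same i j ⟧) (*-comm m _))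
                                       (trans (sum-*ʳ (λ j → ⟦ same i j ⟧) m) (trans (cong (_* m) (count-same i)) (*-identityˡ m))))
           (cong₂ _+_ (sum-cong-≗ {m} λ i → trans (sum-cong-≗ {m} λ j → count-same i) ones)
                      (sum-cong-≗ {m} λ i → trans (sum-cong-≗ {m} λ j → count-same j) ones)) ⟩
    sum {m} (λ _ → m) + (sum {m} (λ _ → m) + sum {m} (λ _ → m))
      ≡⟨ cong (λ z → z + (z + z)) (sum-const m m) ⟩
    m * m + (m * m + m * m)
      ≡⟨ cong (λ z → m * m + (m * m + z)) (+-identityʳ (m * m)) ⟨
    3 * (m * m) ∎
    where
    open ≡-Reasoning
    ones : sum {m} (λ _ → 1) ≡ m
    ones = trans (sum-const m 1) (*-identityʳ m)

  edge-bound : ∀ ν → m ≡ 3 * ν → 12 * (ν * ν * ν) ≤ sum₃ (λ i j k → ⟦ τ i j k ⟧) + 3 * (m * m)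
  edge-bound ν m≡3ν = begin
    12 * (ν * ν * ν)
      ≤⟨ size²+3out²≥12ν³ ν m≡3ν ⟩
    sum (λ i → size i * size i) + 3 * sum (λ i → out i * out i)
      ≡⟨ pattern-sum ⟨
    sum₃ pattern-count
      ≤⟨ sum-mono (λ i → sum-mono λ j → sum-mono λ k → pattern≤edge i j k) ⟩
    sum₃ (λ i j k → ⟦ τ i j k ⟧ + (d₁ i j k + (d₂ i j k + d₃ i j k)))
      ≡⟨ sum₃-+ (λ i j k → ⟦ τ i j k ⟧) (λ i j k → d₁ i j k + (d₂ i j k + d₃ i j k)) ⟩
    sum₃ (λ i j k → ⟦ τ i j k ⟧) + sum₃ (λ i j k → d₁ i j k + (d₂ i j k + d₃ i j k))
      ≡⟨ cong (sum₃ (λ i j k → ⟦ τ i j k ⟧) +_) diagonals ⟩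
    sum₃ (λ i j k → ⟦ τ i j k ⟧) + 3 * (m * m) ∎
    where open ≤-Reasoning

-- Forbidden configurations inside a box

-- Conjunctions over increasing index tuples that unfold to nested pairs: a copy of a concrete graph
-- is exhibited by listing one proof for each pair and each triple.
Ones : ∀ n → (Fin n → Set) → Set
Ones zero    P = ⊤
Ones (suc n) P = P zero × Ones n (P ∘ suc)

Pairs : ∀ n → (Fin n → Fin n → Set) → Set
Pairs zero    P = ⊤
Pairs (suc n) P = Ones n (λ j → P zero (suc j)) × Pairs n (λ i j → P (suc i) (suc j))

Triples : ∀ n → (Fin n → Fin n → Fin n → Set) → Set
Triples zero    P = ⊤
Triples (suc n) P = Pairs n (λ j k → P zero (suc j) (suc k)) × Triples n (λ i j k → P (suc i) (suc j) (suc k))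

ones : ∀ {n} {P : Fin n → Set} → Ones n P → ∀ i → P i
ones (p , ps) zero    = p
ones (p , ps) (suc i) = ones ps i

pairs : ∀ {n} {P : Fin n → Fin n → Set} → Pairs n P → ∀ i j → i F.< j → P i j
pairs (p , ps) zero    (suc j) l       = ones p j
pairs (p , ps) (suc i) (suc j) (s≤s l) = pairs ps i j l

triples : ∀ {n} {P : Fin n → Fin n → Fin n → Set} → Triples n P →
          ∀ i j k → i F.< j → j F.< k → P i j k
triples (p , ps) zero    (suc j) (suc k) l       (s≤s r) = pairs p j k r
triples (p , ps) (suc i) (suc j) (suc k) (s≤s l) (s≤s r) = triples ps i j k l r

pairs-injective : ∀ {n} {A : Set} (f : Fin n → A) → Pairs n (λ i j → f i ≢ f j) → Injective _≡_ _≡_ f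
pairs-injective f ps {i} {j} e with FP.<-cmp i j
... | tri< l _ _ = ⊥-elim (pairs ps i j l e)
... | tri≈ _ h _ = h
... | tri> _ _ g = ⊥-elim (pairs ps j i g (sym e))

tri-swap₁ : ∀ {n} (a b c : Fin n) → tri a b c ≡ tri b a c
tri-swap₁ a b c = trans (sym (∪-assoc _ _ _)) (trans (cong (λ z → z ∪ _) (∪-comm _ _)) (∪-assoc _ _ _))

tri-swap₂ : ∀ {n} (a b c : Fin n) → tri a b c ≡ tri a c b
tri-swap₂ a b c = cong (_ ∪_) (∪-comm _ _)

distinct₃ : ∀ {n} → Fin n → Fin n → Fin n → Bool
distinct₃ a b c = not (same a b) ∧ (not (same a c) ∧ not (same b c))

-- The values of a graph on sets of fewer than three elements are arbitrary; here they are replaced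
-- by `false`.
edge : ∀ {n} → Graph3 n → Fin n → Fin n → Fin n → Bool
edge G a b c = distinct₃ a b c ∧ G (tri a b c)

edge-swap₁ : ∀ {n} (G : Graph3 n) a b c → edge G a b c ≡ edge G b a c
edge-swap₁ G a b c = cong₂ _∧_
  (cong₂ _∧_ (cong not (same-sym a b)) (∧-comm (not (same a c)) (not (same b c))))
  (cong G (tri-swap₁ a b c))

edge-swap₂ : ∀ {n} (G : Graph3 n) a b c → edge G a b c ≡ edge G a c b
edge-swap₂ G a b c = cong₂ _∧_
  (trans (sym (∧-assoc (not (same a b)) _ _)) (trans (cong₂ _∧_ (∧-comm (not (same a b)) (not (same a c))) (cong not (same-sym b c)))
    (∧-assoc (not (same a c)) _ _)))
  (cong G (tri-swap₂ a b c))

edge-rotate : ∀ {n} (G : Graph3 n) a b c → edge G a b c ≡ edge G b c a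
edge-rotate G a b c = trans (edge-swap₁ G a b c) (edge-swap₂ G b a c)

edge-distinct : ∀ {n} (G : Graph3 n) {a b c} → a ≢ b → a ≢ c → b ≢ c → edge G a b c ≡ G (tri a b c)
edge-distinct G ab ac bc rewrite same-≢ ab | same-≢ ac | same-≢ bc = refl

induced : ∀ {k n} (H : Graph3 k) (G : Graph3 n) (v : Vec (Fin n) k) →
          Pairs k (λ i j → lookup v i ≢ lookup v j) →
          Triples k (λ i j l → H (tri i j l) ≡ edge G (lookup v i) (lookup v j) (lookup v l)) →
          InducedIn H G
induced H G v ps ts = lookup v , pairs-injective (lookup v) ps , λ a b c l r →
  trans (triples ts a b c l r)
        (edge-distinct G (pairs ps a b l) (pairs ps a c (FP.<-trans l r)) (pairs ps b c r))

module BoxStructure {n m : ℕ} (G : Graph3 n) (free : Free G) (β : Fin m → Bool → Fin n)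
  (twins   : ∀ i → β i true ≢ β i false)
  (apart   : ∀ i j u v → i ≢ j → β i u ≢ β j v)
  (uniform : ∀ i j k u v w → i ≢ j → i ≢ k → j ≢ k →
             edge G (β i u) (β j v) (β k w) ≡ edge G (β i true) (β j true) (β k true))
  (homogeneous : ∀ i j → i ≢ j → edge G (β i true) (β i false) (β j true) ≡ edge G (β i true) (β i false) (β j false))
  where

  σ : Fin m → Fin m → Bool
  σ i j = edge G (β i true) (β i false) (β j true)

  τ : Fin m → Fin m → Fin m → Bool
  τ i j k = edge G (β i true) (β j true) (β k true)

  σ-first : ∀ i j v {b} → i ≢ j → σ i j ≡ b → b ≡ edge G (β i true) (β i false) (β j v)
  σ-first i j true  ij e = sym e
  σ-first i j false ij e = sym (trans (sym (homogeneous i j ij)) e)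

  σ-last : ∀ i j v {b} → i ≢ j → σ i j ≡ b → b ≡ edge G (β j v) (β i true) (β i false)
  σ-last i j v ij e = trans (σ-first i j v ij e) (sym (edge-rotate G (β j v) (β i true) (β i false)))

  τ-at : ∀ i j k u v w {b} → i ≢ j → i ≢ k → j ≢ k → τ i j k ≡ b → b ≡ edge G (β i u) (β j v) (β k w)
  τ-at i j k u v w ij ik jk e = sym (trans (uniform i j k u v w ij ik jk) e)

  -- If both arrows failed, the two pairs of twins would form an `I34`.
  total : ∀ i j → i ≢ j → σ i j ≡ false → σ j i ≡ true
  total i j ij a with σ j i in b
  ... | true  = refl
  ... | false = ⊥-elim (proj₁ free (induced I34 G (β i true ∷ β i false ∷ β j true ∷ β j false ∷ [])
    ((twins i , apart i j _ _ ij , apart i j _ _ ij , tt) , (apart i j _ _ ij , apart i j _ _ ij , tt) ,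
     (twins j , tt) , tt , tt)
    (((σ-first i j true ij a , σ-first i j false ij a , tt) , (σ-last j i true (ij ∘ sym) b , tt) , tt , tt) ,
     ((σ-last j i false (ij ∘ sym) b , tt) , tt , tt) , (tt , tt) , tt , tt)))

  five : Fin m → Fin m → Fin m → Vec (Fin n) 5
  five i j k = β i true ∷ β i false ∷ β j true ∷ β j false ∷ β k true ∷ []

  clique+1 : ∀ i j k → i ≢ j → i ≢ k → j ≢ k → Pairs 5 (λ a b → lookup (five i j k) a ≢ lookup (five i j k) b)
  clique+1 i j k ij ik jk =
    (twins i , apart i j _ _ ij , apart i j _ _ ij , apart i k _ _ ik , tt) ,
    (apart i j _ _ ij , apart i j _ _ ij , apart i k _ _ ik , tt) ,
    (twins j , apart j k _ _ jk , tt) , (apart j k _ _ jk , tt) , tt , tt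

  -- Two pairs of twins with arrows both ways span all four triples. If ijk were not an edge, a
  -- vertex of class k would add just the two edges that it forms with the pairs, which gives `H1`.
  joint : ∀ i j k → i ≢ j → i ≢ k → j ≢ k → σ i j ≡ true → σ j i ≡ true →
          σ i k ≡ true → σ j k ≡ true → τ i j k ≡ true
  joint i j k ij ik jk a b c d with τ i j k in e
  ... | true  = refl
  ... | false = ⊥-elim (proj₁ (proj₂ free) (induced H1 G (five i j k) (clique+1 i j k ij ik jk)
    (((σ-first i j true ij a , σ-first i j false ij a , σ-first i k true ik c , tt) ,
      (σ-last j i true (ij ∘ sym) b , τ-at i j k true true true ij ik jk e , tt) , (τ-at i j k true false true ij ik jk e , tt) , tt , tt) ,
     ((σ-last j i false (ij ∘ sym) b , τ-at i j k false true true ij ik jk e , tt) , (τ-at i j k false false true ij ik jk e , tt) , tt , tt) ,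
     ((σ-first j k true jk d , tt) , tt , tt) , (tt , tt) , tt , tt)))

  -- Again four twins span all their triples, and now all transversal triples are present. If k
  -- formed an edge with the twins of j but not with those of i, this would be `H3`; the pair of j
  -- comes first to match its edge 125.
  spread : ∀ i j k → i ≢ j → i ≢ k → j ≢ k → σ i j ≡ true → σ j i ≡ true →
           σ j k ≡ true → τ i j k ≡ true → σ i k ≡ true
  spread i j k ij ik jk a b c d with σ i k in e
  ... | true  = refl
  ... | false = ⊥-elim (proj₂ (proj₂ (proj₂ free)) (induced H3 G (five j i k) (clique+1 j i k ji jk ik)
    (((σ-first j i true ji b , σ-first j i false ji b , σ-first j k true jk c , tt) ,
      (σ-last i j true ij a , τ-at j i k true true true ji jk ik f , tt) , (τ-at j i k true false true ji jk ik f , tt) , tt , tt) ,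
     ((σ-last i j false ij a , τ-at j i k false true true ji jk ik f , tt) , (τ-at j i k false false true ji jk ik f , tt) , tt , tt) ,
     ((σ-first i k true ik e , tt) , tt , tt) , (tt , tt) , tt , tt)))
    where
    ji : j ≢ i
    ji = ij ∘ sym
    f : τ j i k ≡ true
    f = trans (edge-swap₁ G (β j true) (β i true) (β k true)) d

  -- Otherwise one vertex each of i and j together with both twins of k would form an `I34`.
  source : ∀ i j k → i ≢ j → i ≢ k → j ≢ k → σ k i ≡ false → σ k j ≡ false → τ i j k ≡ true
  source i j k ij ik jk a b with τ i j k in e
  ... | true  = refl
  ... | false = ⊥-elim (proj₁ free (induced I34 G (β i true ∷ β j true ∷ β k true ∷ β k false ∷ [])
    ((apart i j _ _ ij , apart i k _ _ ik , apart i k _ _ ik , tt) , (apart j k _ _ jk , apart j k _ _ jk , tt) ,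
     (twins k , tt) , tt , tt)
    (((τ-at i j k true true true ij ik jk e , τ-at i j k true true false ij ik jk e , tt) , (σ-last k i true (ik ∘ sym) a , tt) , tt , tt) ,
     ((σ-last k j true (jk ∘ sym) b , tt) , tt , tt) , (tt , tt) , tt , tt)))

  turan : ∀ i j k l → i ≢ j → i ≢ k → i ≢ l → j ≢ k → j ≢ l → k ≢ l →
          τ i j k ≡ false → τ i j l ≡ false → τ i k l ≡ false → τ j k l ≡ false → ⊥
  turan i j k l ij ik il jk jl kl a b c d =
    proj₁ free (induced I34 G (β i true ∷ β j true ∷ β k true ∷ β l true ∷ [])
      ((apart i j _ _ ij , apart i k _ _ ik , apart i l _ _ il , tt) , (apart j k _ _ jk , apart j l _ _ jl , tt) ,
       (apart k l _ _ kl , tt) , tt , tt)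
      (((sym a , sym b , tt) , (sym c , tt) , tt , tt) , ((sym d , tt) , tt , tt) , (tt , tt) , tt , tt))

  open Blowup σ τ (λ i j k → edge-swap₁ G (β i true) (β j true) (β k true))
    (λ i j k → edge-swap₂ G (β i true) (β j true) (β k true))
    total joint spread source turan public using (edge-bound)

-- Sampling

-- A coordinate of a uniformly random tuple is a uniformly random vertex, with denominators cleared.
marginal₁ : ∀ {n m} (φ : Fin n → ℕ) (i : Fin m) → n * sumV m (λ x → φ (lookup x i)) ≡ n ^ m * sum φ
marginal₁ {n} {suc m} φ zero = begin
  n * sum (λ b → sumV m λ x → φ b)   ≡⟨ cong (n *_) (trans (sum-cong-≗ {n} λ b → sumV-const n m (φ b)) (sum-*ˡ (n ^ m) φ)) ⟩
  n * (n ^ m * sum φ)                ≡⟨ *-assoc n (n ^ m) (sum φ) ⟨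
  n * n ^ m * sum φ                  ∎
  where open ≡-Reasoning
marginal₁ {n} {suc m} φ (suc i) = begin
  n * sum {n} (λ b → sumV m λ x → φ (lookup x i))   ≡⟨ cong (n *_) (sum-const n _) ⟩
  n * (n * sumV m λ x → φ (lookup x i))             ≡⟨ cong (n *_) (marginal₁ φ i) ⟩
  n * (n ^ m * sum φ)                               ≡⟨ *-assoc n (n ^ m) (sum φ) ⟨
  n * n ^ m * sum φ                                 ∎
  where open ≡-Reasoning

scale-out : ∀ {n} m c d (ψ : Fin n → Vec (Fin n) m → ℕ) (χ : Fin n → ℕ) →
            (∀ b → c * sumV m (ψ b) ≡ d * χ b) → c * sum (λ b → sumV m (ψ b)) ≡ d * sum χ
scale-out {n} m c d ψ χ h =
  trans (sym (sum-*ˡ c (λ b → sumV m (ψ b)))) (trans (sum-cong-≗ {n} h) (sum-*ˡ d χ))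

marginal₂ : ∀ {n m} (φ : Fin n → Fin n → ℕ) (i j : Fin m) → i ≢ j →
            n * n * sumV m (λ x → φ (lookup x i) (lookup x j)) ≡ n ^ m * sum (λ a → sum (φ a))
marginal₂ φ zero zero h = ⊥-elim (h refl)
marginal₂ {n} {suc m} φ zero (suc j) h = begin
  n * n * sum (λ b → sumV m λ x → φ b (lookup x j))     ≡⟨ *-assoc n n _ ⟩
  n * (n * sum (λ b → sumV m λ x → φ b (lookup x j)))   ≡⟨ cong (n *_) (scale-out m n (n ^ m) _ (λ b → sum (φ b)) λ b → marginal₁ (φ b) j) ⟩
  n * (n ^ m * sum (λ a → sum (φ a)))                   ≡⟨ *-assoc n (n ^ m) _ ⟨
  n * n ^ m * sum (λ a → sum (φ a))                     ∎
  where open ≡-Reasoning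
marginal₂ {n} {suc m} φ (suc i) zero h =
  trans (marginal₂ (λ b a → φ a b) zero (suc i) (h ∘ sym)) (cong (n ^ suc m *_) (∑-comm {n} {n} λ b a → φ a b))
marginal₂ {n} {suc m} φ (suc i) (suc j) h = begin
  n * n * sum {n} (λ b → sumV m ψ)              ≡⟨ cong (n * n *_) (sum-const n _) ⟩
  n * n * (n * sumV m ψ)                        ≡⟨ ring n (sumV m ψ) ⟩
  n * (n * n * sumV m ψ)                        ≡⟨ cong (n *_) (marginal₂ φ i j (h ∘ cong suc)) ⟩
  n * (n ^ m * sum (λ a → sum (φ a)))           ≡⟨ *-assoc n (n ^ m) _ ⟨
  n * n ^ m * sum (λ a → sum (φ a))             ∎
  where
  open ≡-Reasoning
  ψ : Vec (Fin n) m → ℕ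
  ψ x = φ (lookup x i) (lookup x j)
  ring : ∀ n s → n * n * (n * s) ≡ n * (n * n * s)
  ring = solve-∀

-- If one of the three positions is zero, the symmetry of `φ` moves it to the front; summing over it
-- separately leaves `marginal₂`.
marginal₃ : ∀ {n m} (φ : Fin n → Fin n → Fin n → ℕ) →
            (∀ a b c → φ a b c ≡ φ b a c) → (∀ a b c → φ a b c ≡ φ a c b) →
            ∀ (i j k : Fin m) → i ≢ j → i ≢ k → j ≢ k →
            n * n * n * sumV m (λ x → φ (lookup x i) (lookup x j) (lookup x k)) ≡ n ^ m * sum₃ φ
marginal₃ {n} {suc m} φ s₁ s₂ zero (suc j) (suc k) ij ik jk = begin
  n * n * n * sum (λ b → sumV m (ψ b))          ≡⟨ ring n _ ⟩
  n * (n * n * sum (λ b → sumV m (ψ b)))        ≡⟨ cong (n *_) (scale-out m (n * n) (n ^ m) ψ (λ b → sum λ a → sum (φ b a))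
                                                     λ b → marginal₂ (φ b) j k (jk ∘ cong suc)) ⟩
  n * (n ^ m * sum₃ φ)                          ≡⟨ *-assoc n (n ^ m) _ ⟨
  n * n ^ m * sum₃ φ                            ∎
  where
  open ≡-Reasoning
  ψ : Fin n → Vec (Fin n) m → ℕ
  ψ b x = φ b (lookup x j) (lookup x k)
  ring : ∀ n s → n * n * n * s ≡ n * (n * n * s)
  ring = solve-∀
marginal₃ {n} {suc m} φ s₁ s₂ (suc i) zero (suc k) ij ik jk =
  trans (cong (n * n * n *_) (sumV-cong (suc m) λ x → s₁ (lookup x (suc i)) (lookup x zero) (lookup x (suc k))))
        (marginal₃ φ s₁ s₂ zero (suc i) (suc k) (ij ∘ sym) jk ik)
marginal₃ {n} {suc m} φ s₁ s₂ (suc i) (suc j) zero ij ik jk =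
  trans (cong (n * n * n *_) (sumV-cong (suc m) λ x →
           trans (s₂ (lookup x (suc i)) (lookup x (suc j)) (lookup x zero)) (s₁ (lookup x (suc i)) (lookup x zero) (lookup x (suc j)))))
        (marginal₃ φ s₁ s₂ zero (suc i) (suc j) (ik ∘ sym) (jk ∘ sym) ij)
marginal₃ {n} {suc m} φ s₁ s₂ (suc i) (suc j) (suc k) ij ik jk = begin
  n * n * n * sum {n} (λ b → sumV m ψ)          ≡⟨ cong (n * n * n *_) (sum-const n _) ⟩
  n * n * n * (n * sumV m ψ)                    ≡⟨ ring n (sumV m ψ) ⟩
  n * (n * n * n * sumV m ψ)                    ≡⟨ cong (n *_) (marginal₃ φ s₁ s₂ i j k (ij ∘ cong suc) (ik ∘ cong suc) (jk ∘ cong suc)) ⟩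
  n * (n ^ m * sum₃ φ)                          ≡⟨ *-assoc n (n ^ m) _ ⟨
  n * n ^ m * sum₃ φ                            ∎
  where
  open ≡-Reasoning
  ψ : Vec (Fin n) m → ℕ
  ψ x = φ (lookup x i) (lookup x j) (lookup x k)
  ring : ∀ n s → n * n * n * (n * s) ≡ n * (n * n * n * s)
  ring = solve-∀
marginal₃ φ s₁ s₂ zero zero k ij ik jk = ⊥-elim (ij refl)
marginal₃ φ s₁ s₂ zero (suc j) zero ij ik jk = ⊥-elim (ik refl)
marginal₃ φ s₁ s₂ (suc i) zero zero ij ik jk = ⊥-elim (jk refl)

edge-loop₁ : ∀ {n} (G : Graph3 n) a b → edge G a a b ≡ false
edge-loop₁ G a b rewrite same-refl a = refl

edge-loop₂ : ∀ {n} (G : Graph3 n) a b → edge G a b b ≡ false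
edge-loop₂ G a b = trans (edge-rotate G a b b) (edge-loop₁ G b a)

edge-loop₃ : ∀ {n} (G : Graph3 n) a b → edge G a b a ≡ false
edge-loop₃ G a b = trans (edge-swap₂ G a b a) (edge-loop₁ G a b)

edge-sum : ∀ {n} → Graph3 n → ℕ
edge-sum G = sum₃ λ a b c → ⟦ edge G a b c ⟧

sampled : ∀ {n m} → Graph3 n → Vec (Fin n) m → ℕ
sampled G x = sum₃ λ i j k → ⟦ edge G (lookup x i) (lookup x j) (lookup x k) ⟧

-- Index triples with a repetition contribute nothing to the left side; for the others `marginal₃`
-- gives equality.
sample-average : ∀ {n} m (G : Graph3 n) → n * n * n * sumV m (sampled G) ≤ m * m * m * (n ^ m * edge-sum G)
sample-average {n} m G = begin
  n * n * n * sumV m (sampled G)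
    ≡⟨ cong (n * n * n *_) (trans (sumV-sum m λ i x → sum λ j → sum λ k → φ i j k x) (sum-cong-≗ {m} λ i →
         trans (sumV-sum m λ j x → sum λ k → φ i j k x) (sum-cong-≗ {m} λ j → sumV-sum m (φ i j)))) ⟩
  n * n * n * sum₃ (λ i j k → sumV m (φ i j k))
    ≡⟨ pull (n * n * n) ⟨
  sum₃ (λ i j k → n * n * n * sumV m (φ i j k))
    ≤⟨ sum-mono (λ i → sum-mono λ j → sum-mono λ k → each i j k) ⟩
  sum₃ (λ (i j k : Fin m) → C)
    ≡⟨ trans (sum-cong-≗ {m} λ i → trans (sum-cong-≗ {m} λ j → sum-const m C) (sum-const m (m * C))) (sum-const m (m * (m * C))) ⟩
  m * (m * (m * C))
    ≡⟨ trans (cong (m *_) (sym (*-assoc m m C))) (trans (sym (*-assoc m (m * m) C)) (cong (_* C) (sym (*-assoc m m m)))) ⟩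
  m * m * m * C ∎
  where
  open ≤-Reasoning
  C : ℕ
  C = n ^ m * edge-sum G
  φ : Fin m → Fin m → Fin m → Vec (Fin n) m → ℕ
  φ i j k x = ⟦ edge G (lookup x i) (lookup x j) (lookup x k) ⟧
  pull : ∀ c → sum₃ (λ i j k → c * sumV m (φ i j k)) ≡ c * sum₃ (λ i j k → sumV m (φ i j k))
  pull c = trans (sum-cong-≗ {m} λ i → trans (sum-cong-≗ {m} λ j → sum-*ˡ c (λ k → sumV m (φ i j k)))
                                               (sum-*ˡ c (λ j → sum λ k → sumV m (φ i j k))))
                 (sum-*ˡ c (λ i → sum λ j → sum λ k → sumV m (φ i j k)))
  vanish : ∀ i j k → (∀ x → edge G (lookup x i) (lookup x j) (lookup x k) ≡ false) → n * n * n * sumV m (φ i j k) ≤ C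
  vanish i j k h = ≤-trans (≤-reflexive (trans (cong (n * n * n *_)
    (trans (sumV-cong m λ x → cong ⟦_⟧ (h x)) (trans (sumV-const n m 0) (*-zeroʳ (n ^ m))))) (*-zeroʳ (n * n * n)))) z≤n
  each : ∀ i j k → n * n * n * sumV m (φ i j k) ≤ C
  each i j k with i ≟ j | i ≟ k | j ≟ k
  ... | yes refl | _ | _ = vanish i i k λ x → edge-loop₁ G (lookup x i) (lookup x k)
  ... | no _ | yes refl | _ = vanish i j i λ x → edge-loop₃ G (lookup x i) (lookup x j)
  ... | no _ | no _ | yes refl = vanish i j j λ x → edge-loop₂ G (lookup x i) (lookup x j)
  ... | no ij | no ik | no jk = ≤-reflexive (marginal₃ (λ a b c → ⟦ edge G a b c ⟧)
        (λ a b c → cong ⟦_⟧ (edge-swap₁ G a b c)) (λ a b c → cong ⟦_⟧ (edge-swap₂ G a b c)) i j k ij ik jk)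

-- The lower bound for the edge density

deficient : ∀ {n} ν → Graph3 n → Vec (Fin n) (3 * ν) → Bool
deficient ν G x = (sampled G x + 3 * (3 * ν * (3 * ν))) <ᵇ 12 * (ν * ν * ν)

-- The answers determine the isomorphism type of a tuple. Coincidences occupy the extra index
-- `zero`, so that a single call of `refine₃` settles them together with the edges.
type-test : ∀ {n m} → Graph3 n → Fin m → Fin m → Fin (suc m) → Vec (Fin n) m → Bool
type-test G i j zero    x = same (lookup x i) (lookup x j)
type-test G i j (suc k) x = edge G (lookup x i) (lookup x j) (lookup x k)

-- All transversals of the box lie in `P′` and so have the same type. This makes the twins uniform,
-- and `edge-bound` applies to the transversal of the `true` twins.
box-sample : ∀ {n m} (G : Graph3 n) → Free G → (P : Vec (Fin n) m → Bool) →
             (P′ : Vec (Fin n) m → Bool) → (∀ x → P′ x ≡ true → P x ≡ true) →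
            (∀ i j k → Settles P′ (type-test G i j k)) → Box (edge G) P′ → ∀ ν → m ≡ 3 * ν →
            ∃ λ x → P x ≡ true × 12 * (ν * ν * ν) ≤ sampled G x + 3 * (m * m)
box-sample {n} {m} G free P P′ sub settled b ν m≡3ν = x , sub x (inside λ _ → true) , (begin
  12 * (ν * ν * ν)
    ≤⟨ edge-bound ν m≡3ν ⟩
  sum₃ (λ i j k → ⟦ edge G (β i true) (β j true) (β k true) ⟧) + 3 * (m * m)
    ≡⟨ cong (_+ 3 * (m * m)) (sum-cong-≗ {m} λ i → sum-cong-≗ {m} λ j → sum-cong-≗ {m} λ k →
         cong ⟦_⟧ (edge-cong (at i) (at j) (at k))) ⟨
  sampled G x + 3 * (m * m) ∎)
  where
  open Box b
  open ≤-Reasoning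
  edge-cong : ∀ {a a′ b b′ c c′} → a ≡ a′ → b ≡ b′ → c ≡ c′ → edge G a b c ≡ edge G a′ b′ c′
  edge-cong refl refl refl = refl
  x : Vec (Fin n) m
  x = tabulate λ i → β i true
  at : ∀ i → lookup x i ≡ β i true
  at = lookup∘tabulate λ i → β i true
  -- A transversal with twins prescribed at i and j; `w` serves everywhere else, in particular at a
  -- third index k.
  choose : Fin m → Fin m → Bool → Bool → Bool → Fin m → Bool
  choose i j u v w l = if same i l then u else if same j l then v else w
  choose-i : ∀ i j u v w → choose i j u v w i ≡ u
  choose-i i j u v w rewrite same-refl i = refl
  choose-j : ∀ i j u v w → i ≢ j → choose i j u v w j ≡ v
  choose-j i j u v w ij rewrite same-≢ ij | same-refl j = refl
  choose-k : ∀ i j k u v w → i ≢ k → j ≢ k → choose i j u v w k ≡ w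
  choose-k i j k u v w ik jk rewrite same-≢ ik | same-≢ jk = refl
  pick-at : ∀ s i → lookup (tabulate λ l → β l (s l)) i ≡ β i (s i)
  pick-at s i = lookup∘tabulate (λ l → β l (s l)) i
  same-settled : ∀ i j → i ≢ j → ∀ u v → same (β i u) (β j v) ≡ proj₁ (settled i j zero)
  same-settled i j ij u v = trans
    (cong₂ same (sym (trans (pick-at s i) (cong (β i) (choose-i i j u v true))))
                (sym (trans (pick-at s j) (cong (β j) (choose-j i j u v true ij)))))
    (proj₂ (settled i j zero) _ (inside s))
    where
    s : Fin m → Bool
    s = choose i j u v true
  -- One coincidence between classes i and j would entail it for every choice of twins, so both
  -- twins of i would equal `β j v` and hence each other.
  apart : ∀ i j u v → i ≢ j → β i u ≢ β j v
  apart i j u v ij e = distinct i (trans (coincide true) (sym (coincide false)))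
    where
    coincide : ∀ u′ → β i u′ ≡ β j v
    coincide u′ with β i u′ ≟ β j v | trans (same-settled i j ij u′ v) (trans (sym (same-settled i j ij u v))
                       (subst (λ z → same (β i u) z ≡ true) e (same-refl (β i u))))
    ... | yes h | _ = h
  uniform : ∀ i j k u v w → i ≢ j → i ≢ k → j ≢ k →
            edge G (β i u) (β j v) (β k w) ≡ edge G (β i true) (β j true) (β k true)
  uniform i j k u v w ij ik jk = trans (value u v w) (sym (value true true true))
    where
    value : ∀ u v w → edge G (β i u) (β j v) (β k w) ≡ proj₁ (settled i j (suc k))
    value u v w = trans
      (edge-cong (sym (trans (pick-at s i) (cong (β i) (choose-i i j u v w))))
                 (sym (trans (pick-at s j) (cong (β j) (choose-j i j u v w ij))))
                 (sym (trans (pick-at s k) (cong (β k) (choose-k i j k u v w ik jk)))))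
      (proj₂ (settled i j (suc k)) _ (inside s))
      where
      s : Fin m → Bool
      s = choose i j u v w
  open BoxStructure G free β distinct apart uniform homogeneous

-- Deficient tuples are those that violate the conclusion of `edge-bound`. If they were dense, they
-- would contain a box of constant type and in it a transversal that satisfies this conclusion.
deficient-sparse : ∀ ν q .{{_ : NonZero q}} → ∃ λ N → ∀ n .{{_ : NonZero n}} → N ≤ n →
                   (G : Graph3 n) → Free G → ¬ Dense (3 * ν) q (deficient ν G)
deficient-sparse ν q = proj₁ b , λ n N≤n G free d →
  let (P′ , d′ , sub , settled) = refine₃ m m (suc m) (type-test G) q (deficient ν G) d
      (x , Px , dense) = box-sample G free (deficient ν G) P′ sub settled (proj₂ b n N≤n (edge G) P′ d′) ν refl
  in <-irrefl refl (<-≤-trans (<ᵇ-true Px) dense)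
  where
  m : ℕ
  m = 3 * ν
  b = box m (2 ^ (m * (m * suc m)) * q) {{m*n≢0 (2 ^ (m * (m * suc m))) q {{m^n≢0 2 (m * (m * suc m))}}}}

-- Divided by 36κn³, this says that the density is at least 4/9 - 13/(36κ). With ν = 4κ, repeated
-- indices cost 1/ν = 9/(36κ), and the deficient tuples, of density at most 1/ν, cost (4/9)/ν =
-- 4/(36κ).
lower-bound : ∀ κ .{{_ : NonZero κ}} → ∃ λ N → ∀ n .{{_ : NonZero n}} → N ≤ n →
              (G : Graph3 n) → Free G → 16 * κ * (n * n * n) ≤ 36 * κ * edge-sum G + 13 * (n * n * n)
lower-bound κ = proj₁ sparse , bound
  where
  open ≤-Reasoning
  ν : ℕ
  ν = 4 * κ
  instance
    ν≢0 : NonZero ν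
    ν≢0 = m*n≢0 4 κ
  sparse : ∃ λ N → ∀ n .{{_ : NonZero n}} → N ≤ n → (G : Graph3 n) → Free G → ¬ Dense (3 * ν) ν (deficient ν G)
  sparse = deficient-sparse ν ν

  -- The letters stand for n^m, n³, the total of `sampled`, `edge-sum` and the number of deficient
  -- tuples.
  arithmetic : ∀ A T W S p .{{_ : NonZero A}} →
    A * (12 * (ν * ν * ν)) ≤ W + (A * (3 * (3 * ν * (3 * ν))) + p * (12 * (ν * ν * ν))) →
    T * W ≤ 3 * ν * (3 * ν) * (3 * ν) * (A * S) → ν * p ≤ A →
    16 * κ * T ≤ 36 * κ * S + 13 * T
  arithmetic A T W S p h₁ h₂ h₃ = *-cancelˡ-≤ (192 * (κ * κ * κ) * A) {{nz}} (begin
    192 * (κ * κ * κ) * A * (16 * κ * T)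
      ≡⟨ ring₁ κ A T ⟩
    ν * T * (A * (12 * (ν * ν * ν)))
      ≤⟨ *-monoʳ-≤ (ν * T) h₁ ⟩
    ν * T * (W + (A * (3 * (3 * ν * (3 * ν))) + p * (12 * (ν * ν * ν))))
      ≡⟨ ring₂ ν T W A p ⟩
    ν * (T * W) + ν * p * (T * (12 * (ν * ν * ν))) + ν * T * (A * (3 * (3 * ν * (3 * ν))))
      ≤⟨ +-monoˡ-≤ _ (+-mono-≤ (*-monoʳ-≤ ν h₂) (*-monoˡ-≤ (T * (12 * (ν * ν * ν))) h₃)) ⟩
    ν * (3 * ν * (3 * ν) * (3 * ν) * (A * S)) + A * (T * (12 * (ν * ν * ν))) + ν * T * (A * (3 * (3 * ν * (3 * ν))))
      ≡⟨ ring₃ κ A S T ⟩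
    192 * (κ * κ * κ) * A * (36 * κ * S + 13 * T) ∎)
    where
    nz : NonZero (192 * (κ * κ * κ) * A)
    nz = m*n≢0 (192 * (κ * κ * κ)) A {{m*n≢0 192 (κ * κ * κ) {{it}} {{m*n≢0 (κ * κ) κ {{m*n≢0 κ κ}}}}}}
    ring₁ : ∀ κ A T → 192 * (κ * κ * κ) * A * (16 * κ * T) ≡ 4 * κ * T * (A * (12 * (4 * κ * (4 * κ) * (4 * κ))))
    ring₁ = solve-∀
    ring₂ : ∀ ν T W A p → ν * T * (W + (A * (3 * (3 * ν * (3 * ν))) + p * (12 * (ν * ν * ν))))
      ≡ ν * (T * W) + ν * p * (T * (12 * (ν * ν * ν))) + ν * T * (A * (3 * (3 * ν * (3 * ν))))
    ring₂ = solve-∀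
    ring₃ : ∀ κ A S T → 4 * κ * (3 * (4 * κ) * (3 * (4 * κ)) * (3 * (4 * κ)) * (A * S))
        + A * (T * (12 * (4 * κ * (4 * κ) * (4 * κ)))) + 4 * κ * T * (A * (3 * (3 * (4 * κ) * (3 * (4 * κ)))))
      ≡ 192 * (κ * κ * κ) * A * (36 * κ * S + 13 * T)
    ring₃ = solve-∀

  bound : ∀ n .{{_ : NonZero n}} → proj₁ sparse ≤ n → (G : Graph3 n) → Free G →
          16 * κ * (n * n * n) ≤ 36 * κ * edge-sum G + 13 * (n * n * n)
  bound n N≤n G free = arithmetic (n ^ m) (n * n * n) (sumV m (sampled G)) (edge-sum G) (countV m P) {{m^n≢0 n m}}
    many (sample-average m G) (<⇒≤ (≰⇒> (proj₂ sparse n N≤n G free)))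
    where
    m Θ Δ : ℕ
    m = 3 * ν
    Θ = 12 * (ν * ν * ν)
    Δ = 3 * (m * m)
    P : Vec (Fin n) m → Bool
    P = deficient ν G
    pointwise : ∀ x → Θ ≤ sampled G x + (Δ + Θ * ⟦ P x ⟧)
    pointwise x with sampled G x + Δ <ᵇ Θ in e
    ... | true  = ≤-trans (≤-reflexive (sym (*-identityʳ Θ))) (≤-trans (m≤n+m _ Δ) (m≤n+m _ (sampled G x)))
    ... | false = ≤-trans (≮⇒≥ λ l → clash (≤⇒<ᵇ l) e)
                    (≤-reflexive (cong (sampled G x +_) (trans (sym (+-identityʳ Δ)) (cong (Δ +_) (sym (*-zeroʳ Θ))))))
    many : n ^ m * Θ ≤ sumV m (sampled G) + (n ^ m * Δ + countV m P * Θ)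
    many = begin
      n ^ m * Θ
        ≡⟨ sumV-const n m Θ ⟨
      sumV {n} m (λ _ → Θ)
        ≤⟨ sumV-mono m pointwise ⟩
      sumV m (λ x → sampled G x + (Δ + Θ * ⟦ P x ⟧))
        ≡⟨ trans (sumV-+ m (sampled G) (λ x → Δ + Θ * ⟦ P x ⟧)) (cong (sumV m (sampled G) +_) (trans (sumV-+ m (λ _ → Δ) (λ x → Θ * ⟦ P x ⟧))
             (cong₂ _+_ (sumV-const n m Δ) (trans (sumV-*ˡ m Θ (λ x → ⟦ P x ⟧)) (*-comm Θ (countV m P)))))) ⟩
      sumV m (sampled G) + (n ^ m * Δ + countV m P * Θ) ∎

-- Ordered triples and edges

sum-allFin : ∀ n (f : Fin n → ℕ) → LA.sum (map f (allFin n)) ≡ sum f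
sum-allFin n f = trans (cong LA.sum (map-tabulate (λ i → i) f)) (tabulated n f)
  where
  tabulated : ∀ n (f : Fin n → ℕ) → LA.sum (L.tabulate f) ≡ sum f
  tabulated zero    f = refl
  tabulated (suc n) f = cong (f zero +_) (tabulated n (f ∘ suc))

_<ᶠ_ : ∀ {n} → Fin n → Fin n → Bool
a <ᶠ b = toℕ a <ᵇ toℕ b

sorted : ∀ {n} → Graph3 n → Fin n → Fin n → Fin n → ℕ
sorted G a b c = ⟦ a <ᶠ b ∧ (b <ᶠ c ∧ G (tri a b c)) ⟧

edges≡sorted : ∀ {n} (G : Graph3 n) → edges G ≡ sum₃ (sorted G)
edges≡sorted {n} G = trans (sum-allFin n _) (sum-cong-≗ {n} λ a → trans (sum-allFin n _) (sum-cong-≗ {n} λ b →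
  trans (sum-allFin n _) (sum-cong-≗ {n} λ c → if-⟦⟧ _)))
  where
  if-⟦⟧ : ∀ b → (if b then 1 else 0) ≡ ⟦ b ⟧
  if-⟦⟧ true  = refl
  if-⟦⟧ false = refl

<ᶠ-irrefl : ∀ {n} (a : Fin n) → a <ᶠ a ≡ false
<ᶠ-irrefl a = ≡false λ h → <-irrefl refl (<ᵇ-true {toℕ a} h)

<ᶠ-asym : ∀ {n} (a b : Fin n) {x} → a <ᶠ b ∧ (b <ᶠ a ∧ x) ≡ false
<ᶠ-asym a b = ≡false λ h → let (p , q) = ∧-split {a <ᶠ b} h in
  <-asym (<ᵇ-true {toℕ a} p) (<ᵇ-true {toℕ b} (proj₁ (∧-split q)))

<ᶠ-flip : ∀ {n} (a b : Fin n) → a ≢ b → b <ᶠ a ≡ not (a <ᶠ b)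
<ᶠ-flip a b ab with FP.<-cmp a b
... | tri< l _ _ rewrite ≤⇒<ᵇ l = ≡false λ h → <-asym l (<ᵇ-true {toℕ b} h)
... | tri≈ _ e _ = ⊥-elim (ab e)
... | tri> ¬l _ g rewrite ≤⇒<ᵇ g | ≡false (¬l ∘ <ᵇ-true {toℕ a}) = refl

<ᶠ-trans : ∀ {n} (a b c : Fin n) → a <ᶠ b ≡ true → b <ᶠ c ≡ true → a <ᶠ c ≡ true
<ᶠ-trans a b c p q = ≤⇒<ᵇ (<-trans (<ᵇ-true {toℕ a} {toℕ b} p) (<ᵇ-true {toℕ b} {toℕ c} q))

-- x, y, z stand for a < b, b < c, a < c. The hypotheses rule out the two cyclic assignments, and
-- each of the six others satisfies exactly one order.
six-orders : ∀ x y z g → (x ≡ true → y ≡ true → z ≡ true) → (x ≡ false → y ≡ false → z ≡ false) →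
  ⟦ g ⟧ ≡ ⟦ x ∧ (y ∧ g) ⟧ + (⟦ z ∧ (not y ∧ g) ⟧ + (⟦ not x ∧ (z ∧ g) ⟧
          + (⟦ y ∧ (not z ∧ g) ⟧ + (⟦ not z ∧ (x ∧ g) ⟧ + ⟦ not y ∧ (not x ∧ g) ⟧))))
six-orders true  true  true  g h k = sym (+-identityʳ _)
six-orders true  true  false g h k = clash (h refl refl) refl
six-orders true  false true  g h k = sym (+-identityʳ _)
six-orders true  false false g h k = sym (+-identityʳ _)
six-orders false true  true  g h k = sym (+-identityʳ _)
six-orders false true  false g h k = sym (+-identityʳ _)
six-orders false false true  g h k = clash refl (k refl refl)
six-orders false false false g h k = refl

edge-sorted : ∀ {n} (G : Graph3 n) a b c → ⟦ edge G a b c ⟧ ≡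
  sorted G a b c + (sorted G a c b + (sorted G b a c + (sorted G b c a + (sorted G c a b + sorted G c b a))))
edge-sorted G a b c = by-cases (a ≟ b) (a ≟ c) (b ≟ c)
  where
  by-cases : Dec (a ≡ b) → Dec (a ≡ c) → Dec (b ≡ c) → ⟦ edge G a b c ⟧ ≡
    sorted G a b c + (sorted G a c b + (sorted G b a c + (sorted G b c a + (sorted G c a b + sorted G c b a))))
  by-cases (yes refl) _ _
    rewrite edge-loop₁ G a c | <ᶠ-irrefl a | <ᶠ-asym a c {G (tri a c a)}
          | ∧-zeroʳ (c <ᶠ a) = refl
  by-cases (no _) (yes refl) _
    rewrite edge-loop₃ G a b | <ᶠ-irrefl a | <ᶠ-asym a b {G (tri a b a)}
          | ∧-zeroʳ (b <ᶠ a) = refl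
  by-cases (no _) (no _) (yes refl)
    rewrite edge-loop₂ G a b | <ᶠ-irrefl b | <ᶠ-asym b a {G (tri b a b)}
          | ∧-zeroʳ (a <ᶠ b) = refl
  by-cases (no ab) (no ac) (no bc)
    rewrite edge-distinct G ab ac bc
          | sym (tri-swap₂ a b c) | sym (tri-swap₁ a b c)
          | trans (tri-swap₂ b c a) (sym (tri-swap₁ a b c))
          | trans (tri-swap₁ c a b) (sym (tri-swap₂ a b c))
          | trans (tri-swap₂ c b a) (trans (tri-swap₁ c a b) (sym (tri-swap₂ a b c)))
          | <ᶠ-flip a b ab | <ᶠ-flip a c ac | <ᶠ-flip b c bc
    = six-orders (a <ᶠ b) (b <ᶠ c) (a <ᶠ c) (G (tri a b c)) (<ᶠ-trans a b c) descending
    where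
    descending : a <ᶠ b ≡ false → b <ᶠ c ≡ false → a <ᶠ c ≡ false
    descending p q = trans (<ᶠ-flip c a (ac ∘ sym)) (cong not (<ᶠ-trans c b a
      (trans (<ᶠ-flip b c bc) (cong not q)) (trans (<ᶠ-flip a b ab) (cong not p))))

edge-sum≡6*edges : ∀ {n} (G : Graph3 n) → edge-sum G ≡ 6 * edges G
edge-sum≡6*edges {n} G = begin
  edge-sum G
    ≡⟨ sum-cong-≗ {n} (λ a → sum-cong-≗ {n} λ b → sum-cong-≗ {n} λ c → edge-sorted G a b c) ⟩
  sum₃ (λ a b c → f a b c + (f a c b + (f b a c + (f b c a + (f c a b + f c b a)))))
    ≡⟨ trans (sum₃-+ f _) (cong (sum₃ f +_) (trans (sum₃-+ (λ a b c → f a c b) _) (cong₂ _+_ (swap₂ f)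
        (trans (sum₃-+ (λ a b c → f b a c) _) (cong₂ _+_ (swap₁ f) (trans (sum₃-+ (λ a b c → f b c a) _)
         (cong₂ _+_ (trans (swap₁ (λ a b c → f a c b)) (swap₂ f)) (trans (sum₃-+ (λ a b c → f c a b) _)
          (cong₂ _+_ (trans (swap₂ (λ a b c → f b a c)) (swap₁ f))
            (trans (swap₁ (λ a b c → f c a b)) (trans (swap₂ (λ a b c → f b a c)) (swap₁ f)))))))))))) ⟩
  s + (s + (s + (s + (s + s))))
    ≡⟨ ring s ⟩
  6 * s
    ≡⟨ cong (6 *_) (edges≡sorted G) ⟨
  6 * edges G ∎
  where
  open ≡-Reasoning
  f : Fin n → Fin n → Fin n → ℕ
  f = sorted G
  s : ℕ
  s = sum₃ f
  swap₁ : ∀ h → sum₃ (λ a b c → h b a c) ≡ sum₃ h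
  swap₁ h = ∑-comm {n} {n} λ a b → sum (h b a)
  swap₂ : ∀ h → sum₃ (λ a b c → h a c b) ≡ sum₃ h
  swap₂ h = sum-cong-≗ {n} λ a → ∑-comm {n} {n} λ b c → h a c b
  ring : ∀ s → s + (s + (s + (s + (s + s)))) ≡ 6 * s
  ring = solve-∀

-- Turán's construction

-- A graph takes a set as its argument, not three vertices; a sum over the set is a symmetric
-- function of its elements that can be read off the characteristic vector.
weight : ∀ {n} → (Fin n → ℕ) → Subset n → ℕ
weight w []      = 0
weight w (b ∷ S) = ⟦ b ⟧ * w zero + weight (w ∘ suc) S

weight-∅ : ∀ {n} (w : Fin n → ℕ) → weight w (Data.Vec.replicate n false) ≡ 0
weight-∅ {zero}  w = refl
weight-∅ {suc n} w = weight-∅ (w ∘ suc)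

weight-insert : ∀ {n} (w : Fin n → ℕ) a S → lookup S a ≡ false → weight w (⁅ a ⁆ ∪ S) ≡ w a + weight w S
weight-insert w zero (false ∷ S) refl =
  cong₂ _+_ (+-identityʳ (w zero)) (cong (weight (w ∘ suc)) (∪-identityˡ S))
weight-insert w (suc a) (b ∷ S) h = trans (cong (⟦ b ⟧ * w zero +_) (weight-insert (w ∘ suc) a S h))
  (ring (⟦ b ⟧ * w zero) (w (suc a)) (weight (w ∘ suc) S))
  where
  ring : ∀ x y z → x + (y + z) ≡ y + (x + z)
  ring = solve-∀

weight-⁅⁆ : ∀ {n} (w : Fin n → ℕ) a → weight w ⁅ a ⁆ ≡ w a
weight-⁅⁆ w zero    = trans (cong₂ _+_ (+-identityʳ (w zero)) (weight-∅ (w ∘ suc))) (+-identityʳ (w zero))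
weight-⁅⁆ w (suc a) = weight-⁅⁆ (w ∘ suc) a

lookup-⁅⁆ : ∀ {n} {a b : Fin n} → a ≢ b → lookup ⁅ b ⁆ a ≡ false
lookup-⁅⁆ {a = zero}  {zero}  h = ⊥-elim (h refl)
lookup-⁅⁆ {a = zero}  {suc b} h = refl
lookup-⁅⁆ {a = suc a} {zero}  h = lookup-replicate a false
lookup-⁅⁆ {a = suc a} {suc b} h = lookup-⁅⁆ (h ∘ cong suc)

weight-tri : ∀ {n} (w : Fin n → ℕ) {a b c} → a ≢ b → a ≢ c → b ≢ c → weight w (tri a b c) ≡ w a + (w b + w c)
weight-tri w {a} {b} {c} ab ac bc = trans
  (weight-insert w a _ (trans (lookup-zipWith _∨_ a ⁅ b ⁆ ⁅ c ⁆) (cong₂ _∨_ (lookup-⁅⁆ ab) (lookup-⁅⁆ ac))))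
  (cong (w a +_) (trans (weight-insert w b _ (lookup-⁅⁆ bc)) (cong (w b +_) (weight-⁅⁆ w c))))

residue : ∀ {n} → Fin n → Fin 3
residue zero                = zero
residue (suc zero)          = suc zero
residue (suc (suc zero))    = suc (suc zero)
residue (suc (suc (suc i))) = residue i

-- Powers of 4: in a sum of three codes each base 4 digit is the multiplicity of a residue, without
-- carries.
code : Fin 3 → ℕ
code zero             = 1
code (suc zero)       = 4
code (suc (suc zero)) = 16

-- The sum of the three codes determines the multiset of residues; the edges are rrr and rr(r+1).
edge-code : ℕ → Bool
edge-code s = (s ≡ᵇ 3) ∨ (s ≡ᵇ 12) ∨ (s ≡ᵇ 48) ∨ (s ≡ᵇ 6) ∨ (s ≡ᵇ 24) ∨ (s ≡ᵇ 33)

rule : Fin 3 → Fin 3 → Fin 3 → Bool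
rule r s t = edge-code (code r + (code s + code t))

turán : ∀ {n} → Graph3 n
turán S = edge-code (weight (code ∘ residue) S)

turán-tri : ∀ {n} {a b c : Fin n} → a ≢ b → a ≢ c → b ≢ c →
            turán (tri a b c) ≡ rule (residue a) (residue b) (residue c)
turán-tri ab ac bc = cong edge-code (weight-tri (code ∘ residue) ab ac bc)

F0 F1 F2 F3 F4 : Fin 5
F0 = zero
F1 = suc zero
F2 = suc (suc zero)
F3 = suc (suc (suc zero))
F4 = suc (suc (suc (suc zero)))

matches : Graph3 5 → (r₀ r₁ r₂ r₃ r₄ : Fin 3) → Bool
matches H r₀ r₁ r₂ r₃ r₄ =
  agree F0 F1 F2 r₀ r₁ r₂ ∧ agree F0 F1 F3 r₀ r₁ r₃ ∧ agree F0 F2 F3 r₀ r₂ r₃ ∧ agree F1 F2 F3 r₁ r₂ r₃ ∧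
  agree F0 F1 F4 r₀ r₁ r₄ ∧ agree F0 F2 F4 r₀ r₂ r₄ ∧ agree F0 F3 F4 r₀ r₃ r₄ ∧
  agree F1 F2 F4 r₁ r₂ r₄ ∧ agree F1 F3 F4 r₁ r₃ r₄ ∧ agree F2 F3 F4 r₂ r₃ r₄
  where
  agree : Fin 5 → Fin 5 → Fin 5 → Fin 3 → Fin 3 → Fin 3 → Bool
  agree i j k r s t = ⌊ H (tri i j k) ≟ᵇ rule r s t ⌋

-- An induced copy of `H` in `turán` assigns residues, possibly repeated, to its five vertices. So
-- for every n it suffices to test 243 assignments.
Unmatched : Graph3 5 → Set
Unmatched H = ∀ r₀ r₁ r₂ r₃ r₄ → matches H r₀ r₁ r₂ r₃ r₄ ≡ false

unmatched? : ∀ H → Dec (Unmatched H)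
unmatched? H = all? λ r₀ → all? λ r₁ → all? λ r₂ → all? λ r₃ → all? λ r₄ → matches H r₀ r₁ r₂ r₃ r₄ ≟ᵇ false

unmatched-H1 : Unmatched H1
unmatched-H1 = from-yes (unmatched? H1)

unmatched-H2 : Unmatched H2
unmatched-H2 = from-yes (unmatched? H2)

unmatched-H3 : Unmatched H3
unmatched-H3 = from-yes (unmatched? H3)

residues-I34 : ∀ r₀ r₁ r₂ r₃ → rule r₀ r₁ r₂ ∨ rule r₀ r₁ r₃ ∨ rule r₀ r₂ r₃ ∨ rule r₁ r₂ r₃ ≡ true
residues-I34 = from-yes (all? λ r₀ → all? λ r₁ → all? λ r₂ → all? λ r₃ →
  rule r₀ r₁ r₂ ∨ rule r₀ r₁ r₃ ∨ rule r₀ r₂ r₃ ∨ rule r₁ r₂ r₃ ≟ᵇ true)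

induced-rule : ∀ {k n} (H : Graph3 k) (f : Fin k → Fin n) → Injective _≡_ _≡_ f →
  (∀ a b c → a F.< b → b F.< c → H (tri a b c) ≡ turán (tri (f a) (f b) (f c))) →
  ∀ a b c → a F.< b → b F.< c → H (tri a b c) ≡ rule (residue (f a)) (residue (f b)) (residue (f c))
induced-rule H f inj h a b c l r = trans (h a b c l r)
  (turán-tri (FP.<⇒≢ l ∘ inj) (FP.<⇒≢ (FP.<-trans l r) ∘ inj) (FP.<⇒≢ r ∘ inj))

¬induced : ∀ {n} H → Unmatched H → ¬ InducedIn {5} {n} H turán
¬induced H un (f , inj , h) = clash
  (∧-true (ok F0 F1 F2 l01 l12) (∧-true (ok F0 F1 F3 l01 l13) (∧-true (ok F0 F2 F3 l02 l23) (∧-true (ok F1 F2 F3 l12 l23)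
    (∧-true (ok F0 F1 F4 l01 l14) (∧-true (ok F0 F2 F4 l02 l24) (∧-true (ok F0 F3 F4 l03 l34)
      (∧-true (ok F1 F2 F4 l12 l24) (∧-true (ok F1 F3 F4 l13 l34) (ok F2 F3 F4 l23 l34))))))))))
  (un (r F0) (r F1) (r F2) (r F3) (r F4))
  where
  r : Fin 5 → Fin 3
  r i = residue (f i)
  ok : ∀ i j k → i F.< j → j F.< k → ⌊ H (tri i j k) ≟ᵇ rule (r i) (r j) (r k) ⌋ ≡ true
  ok i j k l m with H (tri i j k) ≟ᵇ rule (r i) (r j) (r k)
  ... | yes _ = refl
  ... | no ¬e = ⊥-elim (¬e (induced-rule H f inj h i j k l m))
  l01 : F0 F.< F1
  l01 = s≤s z≤n
  l02 : F0 F.< F2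
  l02 = s≤s z≤n
  l03 : F0 F.< F3
  l03 = s≤s z≤n
  l12 : F1 F.< F2
  l12 = s≤s (s≤s z≤n)
  l13 : F1 F.< F3
  l13 = s≤s (s≤s z≤n)
  l14 : F1 F.< F4
  l14 = s≤s (s≤s z≤n)
  l23 : F2 F.< F3
  l23 = s≤s (s≤s (s≤s z≤n))
  l24 : F2 F.< F4
  l24 = s≤s (s≤s (s≤s z≤n))
  l34 : F3 F.< F4
  l34 = s≤s (s≤s (s≤s (s≤s z≤n)))

turán-free : ∀ {n} → Free (turán {n})
turán-free {n} = ¬I34 , ¬induced H1 unmatched-H1 , ¬induced H2 unmatched-H2 , ¬induced H3 unmatched-H3
  where
  ¬I34 : ¬ InducedIn I34 (turán {n})
  ¬I34 (f , inj , h) = none (residues-I34 (r zero) (r (suc zero)) (r (suc (suc zero))) (r (suc (suc (suc zero)))))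
    where
    r : Fin 4 → Fin 3
    r i = residue (f i)
    ir : ∀ a b c → a F.< b → b F.< c → false ≡ rule (r a) (r b) (r c)
    ir = induced-rule I34 f inj h
    none : rule (r zero) (r (suc zero)) (r (suc (suc zero))) ∨ rule (r zero) (r (suc zero)) (r (suc (suc (suc zero))))
           ∨ rule (r zero) (r (suc (suc zero))) (r (suc (suc (suc zero))))
           ∨ rule (r (suc zero)) (r (suc (suc zero))) (r (suc (suc (suc zero)))) ≢ true
    none rewrite sym (ir zero (suc zero) (suc (suc zero)) (s≤s z≤n) (s≤s (s≤s z≤n)))
               | sym (ir zero (suc zero) (suc (suc (suc zero))) (s≤s z≤n) (s≤s (s≤s z≤n)))
               | sym (ir zero (suc (suc zero)) (suc (suc (suc zero))) (s≤s z≤n) (s≤s (s≤s (s≤s z≤n))))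
               | sym (ir (suc zero) (suc (suc zero)) (suc (suc (suc zero))) (s≤s (s≤s z≤n)) (s≤s (s≤s (s≤s z≤n)))) = λ ()

-- n/3 rounded up, the size of the largest residue class.
third : ℕ → ℕ
third (suc (suc (suc n))) = suc (third n)
third zero                = 0
third (suc n)             = 1

3*third≤n+2 : ∀ n → 3 * third n ≤ n + 2
3*third≤n+2 zero                = z≤n
3*third≤n+2 (suc zero)          = ≤-refl
3*third≤n+2 (suc (suc zero))    = s≤s (s≤s (s≤s z≤n))
3*third≤n+2 (suc (suc (suc n))) = ≤-trans (≤-reflexive (*-suc 3 (third n))) (+-monoʳ-≤ 3 (3*third≤n+2 n))

residue-sum : ∀ n (φ : Fin 3 → ℕ) → ∑[ a < n ] φ (residue a) ≤ third n * sum φ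
residue-sum zero φ = z≤n
residue-sum (suc zero) φ = ≤-trans (+-monoʳ-≤ (φ zero) z≤n) (m≤m+n (sum φ) 0)
residue-sum (suc (suc zero)) φ = ≤-trans (+-monoʳ-≤ (φ zero) (+-monoʳ-≤ (φ (suc zero)) z≤n)) (m≤m+n (sum φ) 0)
residue-sum (suc (suc (suc n))) φ = begin
  φ zero + (φ (suc zero) + (φ (suc (suc zero)) + ∑[ a < n ] φ (residue a)))   ≡⟨ ring (φ zero) (φ (suc zero)) (φ (suc (suc zero))) _ ⟩
  sum φ + ∑[ a < n ] φ (residue a)                                            ≤⟨ +-monoʳ-≤ (sum φ) (residue-sum n φ) ⟩
  sum φ + third n * sum φ                                                     ∎
  where
  open ≤-Reasoning
  ring : ∀ x y z w → x + (y + (z + w)) ≡ x + (y + (z + 0)) + w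
  ring = solve-∀

-- Of the 27 ordered triples of residues, 3 have the form rrr and 9 are arrangements of rr(r+1);
-- this is the proportion 12/27 = 4/9.
turán-edge-sum : ∀ n → edge-sum (turán {n}) ≤ 12 * (third n * third n * third n)
turán-edge-sum n = begin
  edge-sum (turán {n})
    ≤⟨ sum-mono {n} (λ a → sum-mono {n} λ b → sum-mono {n} λ c → ⟦⟧-mono (edge-rule a b c)) ⟩
  sum₃ (λ (a b c : Fin n) → φ (residue a) (residue b) (residue c))
    ≤⟨ sum-mono {n} (λ a → sum-mono {n} λ b → residue-sum n (φ (residue a) (residue b))) ⟩
  sum {n} (λ a → sum {n} λ b → u * sum (φ (residue a) (residue b)))
    ≤⟨ sum-mono {n} (λ a → residue-sum n (λ s → u * sum (φ (residue a) s))) ⟩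
  sum {n} (λ a → u * sum (λ s → u * sum (φ (residue a) s)))
    ≤⟨ residue-sum n (λ r → u * sum (λ s → u * sum (φ r s))) ⟩
  u * sum (λ r → u * sum (λ s → u * sum (φ r s)))
    ≡⟨ ring u ⟩
  12 * (u * u * u) ∎
  where
  open ≤-Reasoning
  u : ℕ
  u = third n
  φ : Fin 3 → Fin 3 → Fin 3 → ℕ
  φ r s t = ⟦ rule r s t ⟧
  edge-rule : ∀ a b c → edge (turán {n}) a b c ≡ true → rule (residue a) (residue b) (residue c) ≡ true
  edge-rule a b c h with a ≟ b | a ≟ c | b ≟ c
  ... | no ab | no ac | no bc = trans (sym (turán-tri ab ac bc)) h
  ring : ∀ u → u * (u * (u * 2 + (u * 1 + (u * 1 + 0))) + (u * (u * 1 + (u * 2 + (u * 1 + 0)))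
             + (u * (u * 1 + (u * 1 + (u * 2 + 0))) + 0))) ≡ 12 * (u * u * u)
  ring = solve-∀

-- Existence of the minimum

-- A graph on n + 1 vertices is a pair of graphs on n vertices, for the sets without and with the
-- first vertex. Functions are recovered only up to pointwise equality, which `Φ` therefore has to
-- respect.
search-graph : ∀ n (Φ : Graph3 n → Set) → (∀ {G G′} → G ≗ G′ → Φ G → Φ G′) → (∀ G → Dec (Φ G)) → Dec (∃ Φ)
search-graph zero Φ resp dec with dec (λ _ → true) | dec (λ _ → false)
... | yes p | _     = yes (_ , p)
... | no _  | yes p = yes (_ , p)
... | no ¬t | no ¬f = no λ (G , p) → by-value G p (G []) refl
  where
  by-value : ∀ G → Φ G → ∀ b → G [] ≡ b → ⊥
  by-value G p true  e = ¬t (resp (λ { [] → e }) p)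
  by-value G p false e = ¬f (resp (λ { [] → e }) p)
search-graph (suc n) Φ resp dec =
  map′ (λ (A , B , p) → _ , p)
       (λ (G , p) → G ∘ (false ∷_) , G ∘ (true ∷_) , resp (λ { (false ∷ S) → refl ; (true ∷ S) → refl }) p)
       (search-graph n (λ A → ∃ λ B → Φ (join A B))
         (λ e (B , p) → B , resp (join-cong e (λ S → refl)) p)
         (λ A → search-graph n (λ B → Φ (join A B)) (λ e → resp (join-cong (λ S → refl) e)) (λ B → dec (join A B))))
  where
  join : Graph3 n → Graph3 n → Graph3 (suc n)
  join A B (false ∷ S) = A S
  join A B (true ∷ S)  = B S
  join-cong : ∀ {A A′ B B′} → A ≗ A′ → B ≗ B′ → join A B ≗ join A′ B′
  join-cong e f (false ∷ S) = e S
  join-cong e f (true ∷ S)  = f S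

search-map : ∀ k {n} (Φ : (Fin k → Fin n) → Set) → (∀ {f g} → f ≗ g → Φ f → Φ g) → (∀ f → Dec (Φ f)) → Dec (∃ Φ)
search-map zero Φ resp dec = map′ (λ p → _ , p) (λ (f , p) → resp (λ ()) p) (dec λ ())
search-map (suc k) {n} Φ resp dec =
  map′ (λ (a , f , p) → _ , p)
       (λ (f , p) → f zero , f ∘ suc , resp (λ { zero → refl ; (suc i) → refl }) p)
       (any? λ a → search-map k (λ f → Φ (cons a f))
         (λ e → resp λ { zero → refl ; (suc i) → e i }) (λ f → dec (cons a f)))
  where
  cons : Fin n → (Fin k → Fin n) → Fin (suc k) → Fin n
  cons a f zero    = a
  cons a f (suc i) = f i

induced? : ∀ {k n} (H : Graph3 k) (G : Graph3 n) → Dec (InducedIn H G)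
induced? {k} {n} H G = search-map k _ invariant λ f → injective? f ×-dec preserves? f
  where
  injective? : ∀ f → Dec (Injective _≡_ _≡_ f)
  injective? f = map′ (λ h {i} {j} → h i j) (λ h i j → h {i} {j})
    (all? λ i → all? λ j → (f i ≟ f j) →-dec (i ≟ j))
  Preserves : (Fin k → Fin n) → Set
  Preserves f = ∀ a b c → a F.< b → b F.< c → H (tri a b c) ≡ G (tri (f a) (f b) (f c))
  preserves? : ∀ f → Dec (Preserves f)
  preserves? f = all? λ a → all? λ b → all? λ c → (a FP.<? b) →-dec ((b FP.<? c) →-dec (H (tri a b c) ≟ᵇ _))
  invariant : ∀ {f g} → f ≗ g → Injective _≡_ _≡_ f × Preserves f → Injective _≡_ _≡_ g × Preserves g
  invariant e (inj , h) = (λ {i} {j} q → inj (trans (e i) (trans q (sym (e j))))) ,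
    λ a b c l r → trans (h a b c l r) (cong₂ (λ x S → G (⁅ x ⁆ ∪ S)) (e a) (cong₂ (λ y z → ⁅ y ⁆ ∪ ⁅ z ⁆) (e b) (e c)))

free? : ∀ {n} (G : Graph3 n) → Dec (Free G)
free? G = ¬? (induced? I34 G) ×-dec (¬? (induced? H1 G) ×-dec (¬? (induced? H2 G) ×-dec ¬? (induced? H3 G)))

induced-resp : ∀ {k n} {H : Graph3 k} {G G′ : Graph3 n} → G ≗ G′ → InducedIn H G′ → InducedIn H G
induced-resp e (f , inj , h) = f , inj , λ a b c l r → trans (h a b c l r) (sym (e _))

free-resp : ∀ {n} {G G′ : Graph3 n} → G ≗ G′ → Free G → Free G′
free-resp {G = G} {G′} e (p , q , r , s) =
  p ∘ induced-resp {H = I34} {G} {G′} e , q ∘ induced-resp {H = H1} {G} {G′} e ,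
  r ∘ induced-resp {H = H2} {G} {G′} e , s ∘ induced-resp {H = H3} {G} {G′} e

edges-resp : ∀ {n} {G G′ : Graph3 n} → G ≗ G′ → edges G ≡ edges G′
edges-resp {n} {G} {G′} e = trans (edges≡sorted G) (trans
  (sum-cong-≗ {n} λ a → sum-cong-≗ {n} λ b → sum-cong-≗ {n} λ c → cong (λ x → ⟦ a <ᶠ b ∧ (b <ᶠ c ∧ x) ⟧) (e _))
  (sym (edges≡sorted G′)))

least : ∀ {Q : ℕ → Set} → (∀ e → Dec (Q e)) → ∀ e → Q e → ∃ λ m → Q m × (∀ e′ → Q e′ → m ≤ e′)
least dec e q with dec 0
... | yes q₀ = 0 , q₀ , λ _ _ → z≤n
least dec zero q    | no ¬q₀ = ⊥-elim (¬q₀ q)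
least dec (suc e) q | no ¬q₀ = let (m , qm , min) = least (dec ∘ suc) e q in
  suc m , qm , λ { zero q′ → ⊥-elim (¬q₀ q′) ; (suc e′) q′ → s≤s (min e′ q′) }

-- Being the edge number of a free graph is decidable, and `turán` provides one such number from
-- which the least can be searched.
exmin : ∀ n → ∃ (IsExMin n)
exmin n =
  let (m , attained , min) = least attainable? (edges (turán {n})) (turán , turán-free , refl)
  in m , attained , λ G free → min (edges G) (G , free , refl)
  where
  attainable? : ∀ e → Dec (∃ λ (G : Graph3 n) → Free G × edges G ≡ e)
  attainable? e = search-graph n _ (λ {G} {G′} h (f , q) → free-resp h f , trans (sym (edges-resp {G = G} {G′} h)) q)
    (λ G → free? G ×-dec (edges G Data.Nat.≟ e))

-- The limit

2*C2 : ∀ n → 2 * (suc n C′ 2) ≡ suc n * n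
2*C2 zero    = refl
2*C2 (suc n) = begin
  2 * (suc (suc n) C′ 2)            ≡⟨ cong (2 *_) (nCk+nC[k+1]≡[n+1]C[k+1] (suc n) 1) ⟨
  2 * (suc n C′ 1 + suc n C′ 2)      ≡⟨ *-distribˡ-+ 2 (suc n C′ 1) (suc n C′ 2) ⟩
  2 * (suc n C′ 1) + 2 * (suc n C′ 2)  ≡⟨ cong₂ (λ x y → 2 * x + y) (nC1≡n (suc n)) (2*C2 n) ⟩
  2 * suc n + suc n * n            ≡⟨ ring n ⟩
  suc (suc n) * suc n              ∎
  where
  open ≡-Reasoning
  ring : ∀ n → 2 * suc n + suc n * n ≡ suc (suc n) * suc n
  ring = solve-∀

6*C3 : ∀ n → 6 * ((2 + n) C′ 3) ≡ (2 + n) * (1 + n) * n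
6*C3 zero    = refl
6*C3 (suc n) = begin
  6 * ((3 + n) C′ 3)                              ≡⟨ cong (6 *_) (nCk+nC[k+1]≡[n+1]C[k+1] (2 + n) 2) ⟨
  6 * ((2 + n) C′ 2 + (2 + n) C′ 3)                ≡⟨ split ((2 + n) C′ 2) ((2 + n) C′ 3) ⟩
  3 * (2 * ((2 + n) C′ 2)) + 6 * ((2 + n) C′ 3)    ≡⟨ cong₂ (λ x y → 3 * x + y) (2*C2 (suc n)) (6*C3 n) ⟩
  3 * (suc (suc n) * suc n) + (2 + n) * (1 + n) * n  ≡⟨ ring n ⟩
  (3 + n) * (2 + n) * suc n                      ∎
  where
  open ≡-Reasoning
  split : ∀ x y → 6 * (x + y) ≡ 3 * (2 * x) + 6 * y
  split = solve-∀
  ring : ∀ n → 3 * (suc (suc n) * suc n) + (2 + n) * (1 + n) * n ≡ (3 + n) * (2 + n) * suc n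
  ring = solve-∀

scaled-distance : ∀ κ x y z → κ * x < κ * y + z → κ * y < κ * x + z → κ * ∣ x - y ∣ < z
scaled-distance κ x y z h₁ h₂ with ≤-total x y
... | inj₁ x≤y with m≤n⇒∃[o]m+o≡n x≤y
...   | o , refl rewrite ∣m-m+n∣≡n x o =
  +-cancelˡ-< (κ * x) _ _ (subst (_< κ * x + z) (*-distribˡ-+ κ x o) h₂)
scaled-distance κ x y z h₁ h₂ | inj₂ y≤x with m≤n⇒∃[o]m+o≡n y≤x
...   | o , refl rewrite ∣-∣-comm (y + o) y | ∣m-m+n∣≡n y o =
  +-cancelˡ-< (κ * y) _ _ (subst (_< κ * y + z) (*-distribˡ-+ κ y o) h₁)

module _ (κ m C s : ℕ) .{{_ : NonZero κ}} (8≤s : 8 ≤ s) (6C : 6 * C ≡ (2 + s) * (1 + s) * s) where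

  open ≤-Reasoning

  private
    n : ℕ
    n = 2 + s

  -- Makes the error of `lower-bound` smaller than the permitted one. From s ≥ 8 follows n ≤ 5s/4,
  -- and 13 · 25 = 325 is less than 16 · 36 = 576.
  cube-bound : 13 * (n * n * n) < 36 * (6 * C)
  cube-bound = *-cancelˡ-< 16 _ _ (begin-strict
    16 * (13 * (n * n * n))                  ≡⟨ ring₁ n ⟩
    13 * (n * (4 * n * (4 * n)))             ≤⟨ *-monoʳ-≤ 13 (*-monoʳ-≤ n (*-mono-≤ 4n≤5s 4n≤5s)) ⟩
    13 * (n * (5 * s * (5 * s)))             ≡⟨ ring₂ n s ⟩
    325 * (n * s * s)                        ≤⟨ *-monoˡ-≤ (n * s * s) (m≤m+n 325 251) ⟩
    576 * (n * s * s)                        <⟨ *-monoʳ-< 576 (*-monoˡ-< s {{>-nonZero (≤-trans (s≤s z≤n) 8≤s)}} (*-monoʳ-< n (n<1+n s))) ⟩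
    576 * (n * (1 + s) * s)                  ≡⟨ *-assoc 16 36 (n * (1 + s) * s) ⟩
    16 * (36 * (n * (1 + s) * s))            ≡⟨ cong (λ z → 16 * (36 * z)) 6C ⟨
    16 * (36 * (6 * C))                      ∎)
    where
    4n≤5s : 4 * n ≤ 5 * s
    4n≤5s = begin
      4 * n        ≡⟨ ring s ⟩
      8 + 4 * s    ≤⟨ +-monoˡ-≤ (4 * s) 8≤s ⟩
      5 * s        ∎
      where
      ring : ∀ s → 4 * (2 + s) ≡ 8 + 4 * s
      ring = solve-∀
    ring₁ : ∀ n → 16 * (13 * (n * n * n)) ≡ 13 * (n * (4 * n * (4 * n)))
    ring₁ = solve-∀
    ring₂ : ∀ n s → 13 * (n * (5 * s * (5 * s))) ≡ 325 * (n * s * s)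
    ring₂ = solve-∀

  below : 16 * κ * (n * n * n) ≤ 36 * κ * (6 * m) + 13 * (n * n * n) → κ * (4 * C) < κ * (9 * m) + 9 * C
  below h = *-cancelˡ-< 24 _ _ (begin-strict
    24 * (κ * (4 * C))                       ≡⟨ ring₁ κ C ⟩
    16 * κ * (6 * C)                         ≡⟨ cong (16 * κ *_) 6C ⟩
    16 * κ * (n * (1 + s) * s)               ≤⟨ *-monoʳ-≤ (16 * κ) (*-mono-≤ (*-monoʳ-≤ n (n≤1+n (1 + s))) (m≤n+m s 2)) ⟩
    16 * κ * (n * n * n)                     ≤⟨ h ⟩
    36 * κ * (6 * m) + 13 * (n * n * n)      <⟨ +-monoʳ-< (36 * κ * (6 * m)) cube-bound ⟩
    36 * κ * (6 * m) + 36 * (6 * C)          ≡⟨ ring₂ κ m C ⟩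
    24 * (κ * (9 * m) + 9 * C)               ∎)
    where
    ring₁ : ∀ κ C → 24 * (κ * (4 * C)) ≡ 16 * κ * (6 * C)
    ring₁ = solve-∀
    ring₂ : ∀ κ m C → 36 * κ * (6 * m) + 36 * (6 * C) ≡ 24 * (κ * (9 * m) + 9 * C)
    ring₂ = solve-∀

  -- The left side is the excess of (n + 2)³ over n(n - 1)(n - 2) = 6C.
  quadratic-bound : 9 * (n * n) + 10 * n + 8 < 18 * (n * (1 + s))
  quadratic-bound = begin-strict
    9 * (n * n) + 10 * n + 8                 ≡⟨ ring₁ s ⟩
    9 * (n * (1 + s)) + (19 * n + 8)         <⟨ +-monoʳ-< (9 * (n * (1 + s))) (+-monoʳ-< (19 * n) 8<9n) ⟩
    9 * (n * (1 + s)) + (19 * n + 9 * n)     ≡⟨ cong (9 * (n * (1 + s)) +_) (*-distribʳ-+ n 19 9) ⟨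
    9 * (n * (1 + s)) + 28 * n               ≤⟨ +-monoʳ-≤ (9 * (n * (1 + s))) (*-monoˡ-≤ n (m≤m+n 28 53)) ⟩
    9 * (n * (1 + s)) + 81 * n               ≡⟨ cong (9 * (n * (1 + s)) +_) (trans (*-assoc 9 9 n) (cong (9 *_) (*-comm 9 n))) ⟩
    9 * (n * (1 + s)) + 9 * (n * 9)          ≤⟨ +-monoʳ-≤ (9 * (n * (1 + s))) (*-monoʳ-≤ 9 (*-monoʳ-≤ n (s≤s 8≤s))) ⟩
    9 * (n * (1 + s)) + 9 * (n * (1 + s))    ≡⟨ *-distribʳ-+ (n * (1 + s)) 9 9 ⟨
    18 * (n * (1 + s))                       ∎
    where
    8<9n : 8 < 9 * n
    8<9n = m≤m*n 9 n
    ring₁ : ∀ s → let n = 2 + s in 9 * (n * n) + 10 * n + 8 ≡ 9 * (n * (1 + s)) + (19 * n + 8)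
    ring₁ = solve-∀

  -- The cubic terms cancel against 6C. The quadratic excess, multiplied by 4κ, is less than 9n(n -
  -- 1) · 8κ, and 8κ ≤ n - 2 turns this into 9 · 6C.
  above : 8 * κ ≤ s → 9 * (6 * m) ≤ 4 * ((n + 2) * (n + 2) * (n + 2)) → κ * (9 * m) < κ * (4 * C) + 9 * C
  above κ≤ h = *-cancelˡ-< 6 _ _ (begin-strict
    6 * (κ * (9 * m))                        ≡⟨ ring₁ κ m ⟩
    κ * (9 * (6 * m))                        ≤⟨ *-monoʳ-≤ κ h ⟩
    κ * (4 * ((n + 2) * (n + 2) * (n + 2)))  ≡⟨ ring₂ κ s ⟩
    κ * (4 * X) + 4 * κ * (9 * (n * n) + 10 * n + 8)
                                             <⟨ +-monoʳ-< (κ * (4 * X)) (*-monoʳ-< (4 * κ) {{m*n≢0 4 κ}} quadratic-bound) ⟩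
    κ * (4 * X) + 4 * κ * (18 * (n * (1 + s)))
                                             ≡⟨ cong (κ * (4 * X) +_) (ring₃ κ (n * (1 + s))) ⟩
    κ * (4 * X) + 9 * (n * (1 + s) * (8 * κ)) ≤⟨ +-monoʳ-≤ (κ * (4 * X)) (*-monoʳ-≤ 9 (*-monoʳ-≤ (n * (1 + s)) κ≤)) ⟩
    κ * (4 * X) + 9 * X                      ≡⟨ cong (λ z → κ * (4 * z) + 9 * z) 6C ⟨
    κ * (4 * (6 * C)) + 9 * (6 * C)          ≡⟨ ring₄ κ C ⟩
    6 * (κ * (4 * C) + 9 * C)                ∎)
    where
    X : ℕ
    X = n * (1 + s) * s
    ring₁ : ∀ κ m → 6 * (κ * (9 * m)) ≡ κ * (9 * (6 * m))
    ring₁ = solve-∀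
    ring₂ : ∀ κ s → let n = 2 + s in κ * (4 * ((n + 2) * (n + 2) * (n + 2)))
            ≡ κ * (4 * (n * (1 + s) * s)) + 4 * κ * (9 * (n * n) + 10 * n + 8)
    ring₂ = solve-∀
    ring₃ : ∀ κ x → 4 * κ * (18 * x) ≡ 9 * (x * (8 * κ))
    ring₃ = solve-∀
    ring₄ : ∀ κ C → κ * (4 * (6 * C)) + 9 * (6 * C) ≡ 6 * (κ * (4 * C) + 9 * C)
    ring₄ = solve-∀

from-lower-bound : ∀ κ .{{_ : NonZero κ}} N₀ →
  (∀ n .{{_ : NonZero n}} → N₀ ≤ n → (G : Graph3 n) → Free G →
    16 * κ * (n * n * n) ≤ 36 * κ * edge-sum G + 13 * (n * n * n)) →
  ∃ λ N → ∀ n → N ≤ n → ∃ λ m → IsExMin n m × κ * ∣ 9 * m - 4 * (n C′ 3) ∣ < 9 * (n C′ 3)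
-- From n ≥ 2 + 8κ follows s = n - 2 ≥ 8κ, hence also s ≥ 8.
from-lower-bound κ N₀ lower = N₀ ⊔ (2 + 8 * κ) , λ n N≤n → let (m , ex) = exmin n in
  m , ex , estimate n (m⊔n≤o⇒m≤o N₀ (2 + 8 * κ) N≤n) (m⊔n≤o⇒n≤o N₀ (2 + 8 * κ) N≤n) m ex
  where
  open ≤-Reasoning
  -- Three times n/3 rounded up is at most n + 2, so the 12/27 of the construction become (4/9)(n +
  -- 2)³ ordered edges.
  upper : ∀ n m → m ≤ edges (turán {n}) → 9 * (6 * m) ≤ 4 * ((n + 2) * (n + 2) * (n + 2))
  upper n m m≤ = begin
    9 * (6 * m)                          ≤⟨ *-monoʳ-≤ 9 (*-monoʳ-≤ 6 m≤) ⟩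
    9 * (6 * edges (turán {n}))          ≡⟨ cong (9 *_) (edge-sum≡6*edges (turán {n})) ⟨
    9 * edge-sum (turán {n})             ≤⟨ *-monoʳ-≤ 9 (turán-edge-sum n) ⟩
    9 * (12 * (u * u * u))               ≡⟨ ring u ⟩
    4 * (3 * u * (3 * u) * (3 * u))      ≤⟨ *-monoʳ-≤ 4 (*-mono-≤ (*-mono-≤ u≤ u≤) u≤) ⟩
    4 * ((n + 2) * (n + 2) * (n + 2))    ∎
    where
    u : ℕ
    u = third n
    u≤ : 3 * u ≤ n + 2
    u≤ = 3*third≤n+2 n
    ring : ∀ u → 9 * (12 * (u * u * u)) ≡ 4 * (3 * u * (3 * u) * (3 * u))
    ring = solve-∀

  estimate : ∀ n → N₀ ≤ n → 2 + 8 * κ ≤ n → ∀ m → IsExMin n m → κ * ∣ 9 * m - 4 * (n C′ 3) ∣ < 9 * (n C′ 3)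
  estimate (suc (suc s)) N≤n (s≤s (s≤s 8κ≤s)) m ((G , free , e) , min) =
    scaled-distance κ (9 * m) (4 * C) (9 * C)
      (above κ m C s 8≤s (6*C3 s) 8κ≤s (upper n m (min turán turán-free)))
      (below κ m C s 8≤s (6*C3 s) (subst (λ z → 16 * κ * (n * n * n) ≤ 36 * κ * z + 13 * (n * n * n))
        (trans (edge-sum≡6*edges G) (cong (6 *_) e)) (lower n N≤n G free)))
    where
    n C : ℕ
    n = 2 + s
    C = n C′ 3
    8≤s : 8 ≤ s
    8≤s = ≤-trans (*-monoʳ-≤ 8 (>-nonZero⁻¹ κ)) 8κ≤s

theorem2p1 : PiMinIsFourNinths
theorem2p1 k = let (N₀ , lower) = lower-bound (suc k) in from-lower-bound (suc k) N₀ lower
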